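{- There is a $\tfrac13$-selectable OCRS for matching in general graphs with edge arrivals. That is, for every finite simple (not necessarily bipartite) graph $G=(V,E)$ and every $\mathbf{x}=(x_e)_{e\in E}\in\mathcal{F}$, where $\mathcal{F}=\{\mathbf{y}\in\mathbb{R}^E:\ y_e\ge0\ \forall e\in E,\ \sum_{u:(uv)\in E}y_{uv}\le 1\ \forall v\in V\}$, there is an online algorithm which, for every arrival order of the edges, selects a set $I\subseteq R$ that is a matching and satisfies $\Pr[e\in I\mid e\in R]\ge \tfrac13$ for every $e\in E$ with $x_e>0$, where $R$ is the random set containing each $e\in E$ independently with probability $x_e$.
   Context: Edge arrival model: the edges of $G$ arrive one at a time in an order unknown to the algorithm, fixed by an oblivious adversary (independently of the realization of $R$ and the algorithm's randomness). When $e$ arrives, the algorithm learns whether $e\in R$, and must irrevocably decide whether to include $e$ in $I$ (allowed only if $e\in R$ and $I$ stays a matching). The (possibly randomized) decision may depend on $G$, $\mathbf{x}$, the order of edges arrived so far, which of them are in $R$, previous decisions, and internal randomness. -}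

module Defs where

open import Data.Bool using (Bool; true; false; _∧_; if_then_else_)
open import Data.Fin using (Fin; zero; suc)
import Data.Fin.Properties as Fin
open import Data.Fin.Subset using (Subset; _∈_; _⊆_; _∪_; ⁅_⁆; ⊥)
open import Data.Fin.Subset.Properties using (_∈?_)
open import Data.List using (List; []; _∷_; _++_; map; filter; foldr; allFin)
open import Data.List.Relation.Binary.Permutation.Propositional using (_↭_)
open import Data.List.Relation.Unary.All using (All)
open import Data.Nat as ℕ using (ℕ)
import Data.Nat.Properties as ℕ
open import Data.Product using (Σ-syntax; ∃; ∃₂; _×_; _,_; proj₁; proj₂)
open import Data.Rational as ℚ using (ℚ; 0ℚ; 1ℚ; ½)
import Data.Rational.Properties as ℚ
import Data.Rational.Solver as ℚ
import Data.Integer as ℤ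
open import Data.Sum using (_⊎_)
open import Data.Vec using ([]; _∷_)
open import Function using (_∘_)
open import Function.Bundles using (_⇔_)
open import Level using (0ℓ)
open import Relation.Binary.PropositionalEquality
  using (_≡_; _≢_; refl; sym; trans; cong; cong₂; subst)
open import Relation.Nullary using (Dec; does)
open import Relation.Nullary.Decidable using (_×-dec_; _⊎-dec_; _→-dec_)
open import Relation.Unary using (Pred; Decidable; _∩_)
open import Relation.Unary.Properties using (_∩?_)

Cauchy : (ℕ → ℚ) → Set
Cauchy s = ∀ ε → 0ℚ ℚ.< ε →
  ∃ λ N → ∀ m n → N ℕ.≤ m → N ℕ.≤ n → ℚ.∣ s m ℚ.- s n ∣ ℚ.< ε

-- Equality of reals is not _≡_: two sequences represent the same real when
-- each is _≤_ the other.
record ℝ : Set where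
  constructor mkℝ
  field
    seq    : ℕ → ℚ
    cauchy : Cauchy seq

open ℝ public

module CauchyClosure where
  open import Data.Rational using (_+_; _*_; _-_; -_; ∣_∣; _<_; _≤_; 1/_; Positive; NonZero)
  open ℚ.+-*-Solver

  abstract
    interchange : ∀ a b c d → (a + b) - (c + d) ≡ (a - c) + (b - d)
    interchange = solve 4 (λ a b c d → (a :+ b) :- (c :+ d) := (a :- c) :+ (b :- d)) refl

    neg-sub : ∀ a b → - (a - b) ≡ (- a) - (- b)
    neg-sub = solve 2 (λ a b → :- (a :- b) := (:- a) :- (:- b)) refl

    sub-add : ∀ a b → a ≡ (a - b) + b
    sub-add = solve 2 (λ a b → a := (a :- b) :+ b) refl

    mul-sub : ∀ a b c d → a * b - c * d ≡ a * (b - d) + d * (a - c)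
    mul-sub = solve 4 (λ a b c d → a :* b :- c :* d := a :* (b :- d) :+ d :* (a :- c)) refl

    mul-shuffle : ∀ u v d e → (u * v) * (d * (e * e)) ≡ (d * (u * e)) * (v * e)
    mul-shuffle = solve 4 (λ u v d e →
      (u :* v) :* (d :* (e :* e)) := (d :* (u :* e)) :* (v :* e)) refl

    cross-sub : ∀ u v a b → (u * v) * (b - a) ≡ u * (v * b) - v * (u * a)
    cross-sub = solve 4 (λ u v a b →
      (u :* v) :* (b :- a) := u :* (v :* b) :- v :* (u :* a)) refl
    open ℚ.≤-Reasoning

    half-pos : ∀ {ε} → 0ℚ < ε → 0ℚ < ½ * ε
    half-pos {ε} 0<ε = ℚ.*-monoʳ-<-pos ½ 0<ε

    0*-pos : ∀ {p q} → 0ℚ < p → 0ℚ < q → 0ℚ < p * q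
    0*-pos {p} {q} 0<p 0<q =
      ℚ.positive⁻¹ (p * q) {{ℚ.pos*pos⇒pos p {{ℚ.positive 0<p}} q {{ℚ.positive 0<q}}}}

    const : ∀ q → Cauchy (λ _ → q)
    const q ε 0<ε = 0 , λ _ _ _ _ →
      subst (_< ε) (cong ∣_∣ (sym (ℚ.+-inverseʳ q))) 0<ε

    add : ∀ {s t} → Cauchy s → Cauchy t → Cauchy (λ n → s n + t n)
    add {s} {t} cs ct ε 0<ε
      with cs (½ * ε) (half-pos 0<ε) | ct (½ * ε) (half-pos 0<ε)
    ... | M , hM | N , hN = M ℕ.⊔ N , λ m n p q → begin-strict
      ∣ (s m + t m) - (s n + t n) ∣
        ≡⟨ cong ∣_∣ (interchange (s m) (t m) (s n) (t n)) ⟩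
      ∣ (s m - s n) + (t m - t n) ∣
        ≤⟨ ℚ.∣p+q∣≤∣p∣+∣q∣ (s m - s n) (t m - t n) ⟩
      ∣ s m - s n ∣ + ∣ t m - t n ∣
        <⟨ ℚ.+-mono-< (hM m n (ℕ.m⊔n≤o⇒m≤o M N p) (ℕ.m⊔n≤o⇒m≤o M N q))
                      (hN m n (ℕ.m⊔n≤o⇒n≤o M N p) (ℕ.m⊔n≤o⇒n≤o M N q)) ⟩
      ½ * ε + ½ * ε
        ≡⟨ sym (ℚ.*-distribʳ-+ ε ½ ½) ⟩
      1ℚ * ε
        ≡⟨ ℚ.*-identityˡ ε ⟩
      ε ∎

    neg : ∀ {s} → Cauchy s → Cauchy (λ n → - s n)
    neg {s} cs ε 0<ε with cs ε 0<ε
    ... | N , hN = N , λ m n p q → subst (_< ε)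
      (trans (sym (ℚ.∣-p∣≡∣p∣ (s m - s n)))
        (cong ∣_∣ (neg-sub (s m) (s n))))
      (hN m n p q)

    bounded : ∀ {s} → Cauchy s → ∃₂ λ B N → 0ℚ < B × (∀ n → N ℕ.≤ n → ∣ s n ∣ ≤ B)
    bounded {s} cs with cs 1ℚ (ℚ.positive⁻¹ 1ℚ)
    ... | N , hN = 1ℚ + ∣ s N ∣ , N
      , ℚ.+-mono-<-≤ (ℚ.positive⁻¹ 1ℚ) (ℚ.0≤∣p∣ (s N))
      , λ n p → begin
        ∣ s n ∣
          ≡⟨ cong ∣_∣ (sub-add (s n) (s N)) ⟩
        ∣ (s n - s N) + s N ∣
          ≤⟨ ℚ.∣p+q∣≤∣p∣+∣q∣ (s n - s N) (s N) ⟩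
        ∣ s n - s N ∣ + ∣ s N ∣
          ≤⟨ ℚ.+-monoˡ-≤ ∣ s N ∣ (ℚ.<⇒≤ (hN n N p ℕ.≤-refl)) ⟩
        1ℚ + ∣ s N ∣ ∎

    ∣*∣-bound : ∀ a b {B δ} → 0ℚ < B → ∣ a ∣ ≤ B → ∣ b ∣ < δ → ∣ a * b ∣ < B * δ
    ∣*∣-bound a b {B} {δ} 0<B ha hb = begin-strict
      ∣ a * b ∣     ≡⟨ ℚ.∣p*q∣≡∣p∣*∣q∣ a b ⟩
      ∣ a ∣ * ∣ b ∣ ≤⟨ ℚ.*-monoʳ-≤-nonNeg ∣ b ∣ {{ℚ.∣-∣-nonNeg b}} ha ⟩
      B * ∣ b ∣     <⟨ ℚ.*-monoʳ-<-pos B {{ℚ.positive 0<B}} hb ⟩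
      B * δ         ∎

    mul-close : ∀ a b c d {B C δ} → 0ℚ < B → 0ℚ < C → ∣ a ∣ ≤ B → ∣ d ∣ ≤ C →
                ∣ a - c ∣ < δ → ∣ b - d ∣ < δ → ∣ a * b - c * d ∣ < (B + C) * δ
    mul-close a b c d {B} {C} {δ} 0<B 0<C ha hd hac hbd = begin-strict
      ∣ a * b - c * d ∣
        ≡⟨ cong ∣_∣ (mul-sub a b c d) ⟩
      ∣ a * (b - d) + d * (a - c) ∣
        ≤⟨ ℚ.∣p+q∣≤∣p∣+∣q∣ (a * (b - d)) (d * (a - c)) ⟩
      ∣ a * (b - d) ∣ + ∣ d * (a - c) ∣
        <⟨ ℚ.+-mono-< (∣*∣-bound a (b - d) 0<B ha hbd) (∣*∣-bound d (a - c) 0<C hd hac) ⟩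
      B * δ + C * δ
        ≡⟨ sym (ℚ.*-distribʳ-+ δ B C) ⟩
      (B + C) * δ ∎

    mul-within : ∀ {s t} → Cauchy s → Cauchy t →
      ∀ {B K C L} → 0ℚ < B → (∀ n → K ℕ.≤ n → ∣ s n ∣ ≤ B) →
                    0ℚ < C → (∀ n → L ℕ.≤ n → ∣ t n ∣ ≤ C) →
      ∀ {δ ε} → 0ℚ < δ → (B + C) * δ ≡ ε →
      ∃ λ N → ∀ m n → N ℕ.≤ m → N ℕ.≤ n → ∣ s m * t m - s n * t n ∣ < ε
    mul-within {s} {t} cs ct {K = K} {L = L} 0<B hB 0<C hC {δ} 0<δ eq with cs δ 0<δ | ct δ 0<δ
    ... | M , hM | N , hN = (K ℕ.⊔ L) ℕ.⊔ (M ℕ.⊔ N) , λ m n p q →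
      let KL = K ℕ.⊔ L ; MN = M ℕ.⊔ N
          p₁ = ℕ.m⊔n≤o⇒m≤o KL MN p ; p₂ = ℕ.m⊔n≤o⇒n≤o KL MN p
          q₁ = ℕ.m⊔n≤o⇒m≤o KL MN q ; q₂ = ℕ.m⊔n≤o⇒n≤o KL MN q
      in subst (∣ s m * t m - s n * t n ∣ <_) eq
        (mul-close (s m) (t m) (s n) (t n) 0<B 0<C
          (hB m (ℕ.m⊔n≤o⇒m≤o K L p₁)) (hC n (ℕ.m⊔n≤o⇒n≤o K L q₁))
          (hM m n (ℕ.m⊔n≤o⇒m≤o M N p₂) (ℕ.m⊔n≤o⇒m≤o M N q₂))
          (hN m n (ℕ.m⊔n≤o⇒n≤o M N p₂) (ℕ.m⊔n≤o⇒n≤o M N q₂)))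

    divide : ∀ {k ε} → 0ℚ < k → 0ℚ < ε → ∃ λ δ → 0ℚ < δ × k * δ ≡ ε
    divide {k} {ε} 0<k 0<ε = 1/ k * ε
      , 0*-pos (ℚ.positive⁻¹ (1/ k) {{ℚ.1/pos⇒pos k}}) 0<ε
      , trans (sym (ℚ.*-assoc k (1/ k) ε))
          (trans (cong (_* ε) (ℚ.*-inverseʳ k)) (ℚ.*-identityˡ ε))
      where
      instance
        k-pos : Positive k
        k-pos = ℚ.positive 0<k
        k≢0 : NonZero k
        k≢0 = ℚ.pos⇒nonZero k

    mul : ∀ {s t} → Cauchy s → Cauchy t → Cauchy (λ n → s n * t n)
    mul {s} {t} cs ct ε 0<ε =
      let (B , K , 0<B , hB) = bounded {s} cs
          (C , L , 0<C , hC) = bounded {t} ct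
          (δ , 0<δ , eq)     = divide (ℚ.+-mono-< 0<B 0<C) 0<ε
      in mul-within {s} {t} cs ct 0<B hB 0<C hC 0<δ eq

    inv-nonZero : ∀ {ε p} → 0ℚ < ε → ε ≤ p → NonZero p
    inv-nonZero {ε} {p} 0<ε ε≤p = ℚ.pos⇒nonZero p {{ℚ.positive (ℚ.<-≤-trans 0<ε ε≤p)}}

    inv-sub : ∀ a b u v → u * a ≡ 1ℚ → v * b ≡ 1ℚ → u - v ≡ (u * v) * (b - a)
    inv-sub a b u v ua vb = sym (trans (cross-sub u v a b)
      (trans (cong₂ (λ c d → u * c - v * d) vb ua)
        (cong₂ _-_ (ℚ.*-identityʳ u) (ℚ.*-identityʳ v))))

    inv-close : ∀ {a b u v ε δ} → 0ℚ < u → 0ℚ < v → 0ℚ < ε → 0ℚ < δ → ε ≤ a → ε ≤ b →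
                u * a ≡ 1ℚ → v * b ≡ 1ℚ → ∣ b - a ∣ < δ * (ε * ε) → ∣ u - v ∣ < δ
    inv-close {a} {b} {u} {v} {ε} {δ} 0<u 0<v 0<ε 0<δ ha hb ua vb h = begin-strict
      ∣ u - v ∣
        ≡⟨ cong ∣_∣ (inv-sub a b u v ua vb) ⟩
      ∣ (u * v) * (b - a) ∣
        ≡⟨ ℚ.∣p*q∣≡∣p∣*∣q∣ (u * v) (b - a) ⟩
      ∣ u * v ∣ * ∣ b - a ∣
        ≡⟨ cong (_* ∣ b - a ∣) (ℚ.0≤p⇒∣p∣≡p (ℚ.<⇒≤ 0<uv)) ⟩
      (u * v) * ∣ b - a ∣
        <⟨ ℚ.*-monoʳ-<-pos (u * v) {{ℚ.positive 0<uv}} h ⟩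
      (u * v) * (δ * (ε * ε))
        ≡⟨ mul-shuffle u v δ ε ⟩
      (δ * (u * ε)) * (v * ε)
        ≤⟨ scale (0*-pos 0<δ (0*-pos 0<u 0<ε)) (scale 0<v hb) ⟩
      (δ * (u * ε)) * (v * b)
        ≡⟨ trans (cong ((δ * (u * ε)) *_) vb) (ℚ.*-identityʳ (δ * (u * ε))) ⟩
      δ * (u * ε)
        ≤⟨ scale 0<δ (scale 0<u ha) ⟩
      δ * (u * a)
        ≡⟨ trans (cong (δ *_) ua) (ℚ.*-identityʳ δ) ⟩
      δ ∎
      where
      0<uv : 0ℚ < u * v
      0<uv = 0*-pos 0<u 0<v
      scale : ∀ {p q r} → 0ℚ < r → p ≤ q → r * p ≤ r * q
      scale {r = r} 0<r = ℚ.*-monoˡ-≤-nonNeg r {{ℚ.nonNegative (ℚ.<⇒≤ 0<r)}}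

    inv : ∀ {s} → Cauchy s → ∀ {ε} N (0<ε : 0ℚ < ε)
          (ε≤s : ∀ n → N ℕ.≤ n → ε ≤ s n) →
          Cauchy (λ n → (1/ s (N ℕ.+ n)) {{inv-nonZero 0<ε (ε≤s (N ℕ.+ n) (ℕ.m≤m+n N n))}})
    inv {s} cs {ε} N 0<ε ε≤s δ 0<δ
      with cs (δ * (ε * ε)) (0*-pos 0<δ (0*-pos 0<ε 0<ε))
    ... | M , hM = M , λ m n p q → close (s (N ℕ.+ m)) (s (N ℕ.+ n))
          (ε≤s (N ℕ.+ m) (ℕ.m≤m+n N m)) (ε≤s (N ℕ.+ n) (ℕ.m≤m+n N n))
          (hM (N ℕ.+ n) (N ℕ.+ m) (ℕ.m≤n⇒m≤o+n N q) (ℕ.m≤n⇒m≤o+n N p))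
      where
      1/-pos : ∀ {p} (hp : ε ≤ p) → 0ℚ < (1/ p) {{inv-nonZero 0<ε hp}}
      1/-pos {p} hp = ℚ.positive⁻¹ _ {{ℚ.1/pos⇒pos p {{ℚ.positive (ℚ.<-≤-trans 0<ε hp)}}}}

      close : ∀ a b (ha : ε ≤ a) (hb : ε ≤ b) → ∣ b - a ∣ < δ * (ε * ε) →
              ∣ (1/ a) {{inv-nonZero 0<ε ha}} - (1/ b) {{inv-nonZero 0<ε hb}} ∣ < δ
      close a b ha hb = inv-close (1/-pos ha) (1/-pos hb) 0<ε 0<δ ha hb
        (ℚ.*-inverseˡ a {{inv-nonZero 0<ε ha}}) (ℚ.*-inverseˡ b {{inv-nonZero 0<ε hb}})

infix  4 _≤_ _<_
infixl 6 _+_ _-_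
infixl 7 _*_

fromℚ : ℚ → ℝ
fromℚ q = mkℝ (λ _ → q) (CauchyClosure.const q)

0ℝ 1ℝ ⅓ : ℝ
0ℝ = fromℚ 0ℚ
1ℝ = fromℚ 1ℚ
⅓  = fromℚ (ℤ.+ 1 ℚ./ 3)

_+_ _-_ _*_ : ℝ → ℝ → ℝ
mkℝ s cs + mkℝ t ct = mkℝ (λ n → s n ℚ.+ t n) (CauchyClosure.add {s} {t} cs ct)
mkℝ s cs * mkℝ t ct = mkℝ (λ n → s n ℚ.* t n) (CauchyClosure.mul {s} {t} cs ct)
x - mkℝ t ct        = x + mkℝ (λ n → ℚ.- t n) (CauchyClosure.neg {t} ct)

_≤_ : ℝ → ℝ → Set
x ≤ y = ∀ ε → 0ℚ ℚ.< ε → ∃ λ N → ∀ n → N ℕ.≤ n → seq x n ℚ.≤ seq y n ℚ.+ ε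

_<_ : ℝ → ℝ → Set
x < y = ∃₂ λ ε N → 0ℚ ℚ.< ε × (∀ n → N ℕ.≤ n → seq x n ℚ.+ ε ℚ.≤ seq y n)

-- The witness of 0ℝ < x bounds the sequence away from zero from index N on, so
-- the first N terms are dropped before inverting termwise.
recip : (x : ℝ) → 0ℝ < x → ℝ
recip x (ε , N , 0<ε , h) = mkℝ
  (λ n → (ℚ.1/ seq x (N ℕ.+ n))
           {{CauchyClosure.inv-nonZero 0<ε (ε≤x (N ℕ.+ n) (ℕ.m≤m+n N n))}})
  (CauchyClosure.inv {seq x} (cauchy x) N 0<ε ε≤x)
  where
  ε≤x : ∀ n → N ℕ.≤ n → ε ℚ.≤ seq x n
  ε≤x n N≤n = subst (ℚ._≤ seq x n) (ℚ.+-identityˡ ε) (h n N≤n)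

∑ : List ℝ → ℝ
∑ = foldr _+_ 0ℝ

-- Finitely supported; an outcome may be listed several times.
Dist : Set → Set
Dist A = List (ℝ × A)

pure : ∀ {A} → A → Dist A
pure a = (1ℝ , a) ∷ []

infixl 1 _>>=_

_>>=_ : ∀ {A B} → Dist A → (A → Dist B) → Dist B
[]            >>= f = []
((w , a) ∷ d) >>= f = map (λ (v , b) → (w * v , b)) (f a) ++ (d >>= f)

-- Intended for 0ℝ ≤ p ≤ 1ℝ; for y in 𝓕 (below) every y e satisfies this.
bernoulli : ℝ → Dist Bool
bernoulli p = (p , true) ∷ (1ℝ - p , false) ∷ []

ℙ : ∀ {A} → Dist A → {P : Pred A 0ℓ} → Decidable P → ℝ
ℙ d P? = ∑ (map proj₁ (filter (P? ∘ proj₂) d))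

ℙ-given : ∀ {A} (d : Dist A) {P Q : Pred A 0ℓ} → Decidable P → (Q? : Decidable Q) →
          0ℝ < ℙ d Q? → ℝ
ℙ-given d P? Q? pos = ℙ d (P? ∩? Q?) * recip (ℙ d Q?) pos

randomSubset : ∀ {m} → (Fin m → ℝ) → Dist (Subset m)
randomSubset {ℕ.zero}  x = pure []
randomSubset {ℕ.suc m} x =
  bernoulli (x zero) >>= λ b →
  randomSubset (x ∘ suc) >>= λ R →
  pure (b ∷ R)

-- The orientation of an edge from end₁ to end₂ carries no meaning: `simple`
-- identifies edges with the same unordered pair of endpoints.
record Graph : Set where
  field
    #vertices #edges : ℕ

  Vertex : Set
  Vertex = Fin #vertices

  Edge : Set
  Edge = Fin #edges

  field
    end₁ end₂ : Edge → Vertex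

  Incident : Vertex → Edge → Set
  Incident v e = v ≡ end₁ e ⊎ v ≡ end₂ e

  field
    loopless : ∀ e → end₁ e ≢ end₂ e
    simple   : ∀ e f → (∀ v → Incident v e ⇔ Incident v f) → e ≡ f

  edges : List Edge
  edges = allFin #edges

  incident? : ∀ v e → Dec (Incident v e)
  incident? v e = (v Fin.≟ end₁ e) ⊎-dec (v Fin.≟ end₂ e)

  IsMatching : Subset #edges → Set
  IsMatching I = ∀ e → e ∈ I → ∀ f → f ∈ I → ∀ v → Incident v e → Incident v f → e ≡ f

  isMatching? : Decidable IsMatching
  isMatching? I =
    Fin.all? λ e → (e ∈? I) →-dec Fin.all? λ f → (f ∈? I) →-dec
    Fin.all? λ v → incident? v e →-dec (incident? v f →-dec (e Fin.≟ f))

  -- By simplicity, summing over the edges incident to v is summing over the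
  -- neighbours of v.
  𝓕 : (Edge → ℝ) → Set
  𝓕 y = (∀ e → 0ℝ ≤ y e) × (∀ v → ∑ (map y (filter (incident? v) edges)) ≤ 1ℝ)

record Probability : Set where
  field
    value : ℝ
    0≤v   : 0ℝ ≤ value
    v≤1   : value ≤ 1ℝ

module Online (G : Graph) where
  open Graph G

  record Arrival : Set where
    constructor arrival
    field
      edge     : Edge
      active   : Bool
      selected : Bool

  -- Most recent arrival first.
  History : Set
  History = List Arrival

  -- A randomized online rule: the probability with which to select the arriving
  -- edge, by a fresh coin, given what has been observed. It is consulted only
  -- when selecting is allowed. Since past decisions are part of the history,
  -- reusing earlier internal randomness would add no generality.
  Algorithm : Set
  Algorithm = History → Edge → Probability

  selection : History → Subset #edges
  selection []                      = ⊥
  selection (arrival e _ true  ∷ h) = selection h ∪ ⁅ e ⁆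
  selection (arrival _ _ false ∷ h) = selection h

  decide : Algorithm → Subset #edges → History → Edge → Dist Bool
  decide alg R h e =
    if does (e ∈? R) ∧ does (isMatching? (selection h ∪ ⁅ e ⁆))
    then bernoulli (Probability.value (alg h e))
    else pure false

  run : Algorithm → Subset #edges → List Edge → History → Dist History
  run alg R []       h = pure h
  run alg R (e ∷ es) h =
    decide alg R h e >>= λ d → run alg R es (arrival e (does (e ∈? R)) d ∷ h)

  -- The joint distribution of (R , I), for edges arriving in the given order.
  outcome : Algorithm → (Edge → ℝ) → List Edge → Dist (Subset #edges × Subset #edges)
  outcome alg x es =
    randomSubset x >>= λ R →
    run alg R es [] >>= λ h →
    pure (R , selection h)

  e∈R? : (e : Edge) → Decidable (λ ((R , I) : Subset #edges × Subset #edges) → e ∈ R)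
  e∈R? e (R , I) = e ∈? R

  e∈I? : (e : Edge) → Decidable (λ ((R , I) : Subset #edges × Subset #edges) → e ∈ I)
  e∈I? e (R , I) = e ∈? I

  -- The arrival order is quantified after the algorithm and before R is drawn:
  -- the adversary is oblivious.
  record IsSelectableOCRS (c : ℝ) (x : Edge → ℝ) (alg : Algorithm) : Set where
    field
      selectsMatching :
        (es : List Edge) → es ↭ edges →
        All (λ (_ , (R , I)) → I ⊆ R × IsMatching I) (outcome alg x es)
      selectable :
        (es : List Edge) → es ↭ edges → (e : Edge) → 0ℝ < x e →
        Σ[ pos ∈ 0ℝ < ℙ (outcome alg x es) (e∈R? e) ]
          c ≤ ℙ-given (outcome alg x es) (e∈I? e) (e∈R? e) pos

{-# OPTIONS --safe #-}
-- Select an arriving edge e = uv that is active and can be added to the current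
-- matching with probability ⅓ / p, where p is the probability, determined by the
-- order of arrivals so far, that e can be added.  The earlier history does not
-- depend on whether e is active, so e is selected with probability exactly
-- ⅓ x e, provided that ⅓ ≤ p.  This holds by a union bound: e is blocked only by
-- an edge selected earlier at u or at v, and Σ ⅓ x f ≤ ⅓ over the edges f at
-- each of the two vertices.
module Submission where

open import Defs

open import Data.Bool using (Bool; true; false; _∧_; if_then_else_)
open import Data.Fin using (Fin; zero; suc)
open import Data.Fin.Subset using (Subset; _∈_; _⊆_; _∪_; ⁅_⁆)
open import Data.Fin.Subset.Properties using (_∈?_; ∉⊥; x∈⁅x⁆; x∈⁅y⁆⇒x≡y; x∈p∪q⁻; x∈p∪q⁺)
import Data.Fin.Properties as Fin
open import Data.List using (List; []; _∷_; _++_; map; filter; _ʳ++_)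
import Data.List.Membership.Propositional as List
open import Data.List.Membership.Propositional.Properties using (∈-filter⁺; ∈-allFin)
open import Data.List.Relation.Binary.Permutation.Propositional using (↭-sym; ↭-trans; ↭⇒↭ₛ)
open import Data.List.Relation.Binary.Permutation.Propositional.Properties using (++↭ʳ++; ++-identityʳ; ∈-resp-↭)
open import Data.List.Relation.Binary.Permutation.Setoid.Properties using (Unique-resp-↭)
open import Data.List.Relation.Unary.All as All using (All; []; _∷_)
import Data.List.Relation.Unary.All.Properties as All
open import Data.List.Relation.Unary.AllPairs using ([]; _∷_)
open import Data.List.Relation.Unary.Any using (here; there)
open import Data.List.Relation.Unary.Unique.Propositional using (Unique)
open import Data.List.Relation.Unary.Unique.Propositional.Properties using (allFin⁺)
import Data.Integer as ℤ
open import Data.Nat as ℕ using (ℕ)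
import Data.Nat.Properties as ℕ
open import Data.Product using (∃; _×_; _,_; proj₁; proj₂; map₂)
open import Data.Sum using (inj₁; inj₂)
open import Data.Unit using (⊤; tt)
open import Data.Vec using ([]; _∷_; _[_]≔_)
open import Data.Vec.Properties using ([]≔-minimal; []≔-lookup; []≔-idempotent)
open import Data.Rational as ℚ using (ℚ; 0ℚ; 1ℚ; ½)
import Data.Rational.Properties as ℚ
open import Data.Rational.Solver using (module +-*-Solver)
open import Function using (_∘_)
open import Function.Bundles using (mk⇔)
open import Level using (0ℓ)
open import Relation.Binary.PropositionalEquality
  using (_≡_; _≢_; refl; sym; trans; cong; cong₂; subst; subst₂; setoid)
open import Relation.Nullary using (Dec; yes; no; does; ¬_; contradiction)
open import Relation.Nullary.Decidable using (_×-dec_; dec-true; dec-false; does-⇔)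
open import Relation.Unary using (Pred; Decidable)
open import Relation.Unary.Properties using (_∩?_)
open import Relation.Binary.Bundles using (Preorder)
open +-*-Solver using (solve; _:+_; _:*_; _:-_; :-_; _:=_; con)
open CauchyClosure using (divide; bounded; half-pos)

-- Rational estimates

-- The probability p concerns the algorithm's own past, so the definition looks circular; it is
-- resolved by recursion on the arrival order, since p for an edge depends only on the coins of
-- earlier edges. The quotient by p must also make sense before any bound on p is known, and at
-- every history, even one that repeats an edge. This cap also separates the two bounds. For every
-- p, the capped factor times p is at most 1/3, which gives the upper bound on selection
-- probabilities without any lower bound on p. The union bound then turns it into 1/3 ≤ p, the cap
-- becomes inactive, and the upper bound is attained. The constant: if every edge f is selected with
-- probability c times `x f`, each endpoint blocks with probability at most c, so the argument asks
-- for c ≤ 1 - 2c, and 1/3 is the largest such c.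

p≤∣p∣ : ∀ p → p ℚ.≤ ℚ.∣ p ∣
p≤∣p∣ p with ℚ.≤-total 0ℚ p
... | inj₁ 0≤p = ℚ.≤-reflexive (sym (ℚ.0≤p⇒∣p∣≡p 0≤p))
... | inj₂ p≤0 = ℚ.≤-trans p≤0 (ℚ.0≤∣p∣ p)

p≤q+∣p-q∣ : ∀ p q → p ℚ.≤ q ℚ.+ ℚ.∣ p ℚ.- q ∣
p≤q+∣p-q∣ p q = begin
  p                      ≡⟨ solve 2 (λ p q → p := q :+ (p :- q)) refl p q ⟩
  q ℚ.+ (p ℚ.- q)        ≤⟨ ℚ.+-monoʳ-≤ q (p≤∣p∣ (p ℚ.- q)) ⟩
  q ℚ.+ ℚ.∣ p ℚ.- q ∣    ∎
  where open ℚ.≤-Reasoning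

∣p-q∣≡∣q-p∣ : ∀ p q → ℚ.∣ p ℚ.- q ∣ ≡ ℚ.∣ q ℚ.- p ∣
∣p-q∣≡∣q-p∣ p q = trans (sym (ℚ.∣-p∣≡∣p∣ (p ℚ.- q)))
  (cong ℚ.∣_∣ (solve 2 (λ p q → :- (p :- q) := q :- p) refl p q))

p≤q+r⇒p-q≤r : ∀ {p q r} → p ℚ.≤ q ℚ.+ r → p ℚ.- q ℚ.≤ r
p≤q+r⇒p-q≤r {p} {q} {r} h = subst (p ℚ.- q ℚ.≤_)
  (solve 2 (λ q r → (q :+ r) :- q := r) refl q r) (ℚ.+-monoˡ-≤ (ℚ.- q) h)

∣p-q∣-lub : ∀ {p q r} → p ℚ.≤ q ℚ.+ r → q ℚ.≤ p ℚ.+ r → ℚ.∣ p ℚ.- q ∣ ℚ.≤ r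
∣p-q∣-lub {p} {q} {r} h₁ h₂ with ℚ.∣p∣≡p∨∣p∣≡-p (p ℚ.- q)
... | inj₁ eq = subst (ℚ._≤ r) (sym eq) (p≤q+r⇒p-q≤r h₁)
... | inj₂ eq = subst (ℚ._≤ r)
  (sym (trans eq (solve 2 (λ p q → :- (p :- q) := q :- p) refl p q))) (p≤q+r⇒p-q≤r h₂)

⊔-monoʳ-+∣-∣ : ∀ p q r → p ℚ.⊔ q ℚ.≤ (p ℚ.⊔ r) ℚ.+ ℚ.∣ q ℚ.- r ∣
⊔-monoʳ-+∣-∣ p q r = ℚ.⊔-lub
  (begin
    p                              ≤⟨ ℚ.p≤p⊔q p r ⟩
    p ℚ.⊔ r                        ≡⟨ ℚ.+-identityʳ _ ⟨
    (p ℚ.⊔ r) ℚ.+ 0ℚ               ≤⟨ ℚ.+-monoʳ-≤ (p ℚ.⊔ r) (ℚ.0≤∣p∣ (q ℚ.- r)) ⟩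
    (p ℚ.⊔ r) ℚ.+ ℚ.∣ q ℚ.- r ∣    ∎)
  (begin
    q                              ≤⟨ p≤q+∣p-q∣ q r ⟩
    r ℚ.+ ℚ.∣ q ℚ.- r ∣            ≤⟨ ℚ.+-monoˡ-≤ ℚ.∣ q ℚ.- r ∣ (ℚ.p≤q⊔p p r) ⟩
    (p ℚ.⊔ r) ℚ.+ ℚ.∣ q ℚ.- r ∣    ∎)
  where open ℚ.≤-Reasoning

-- Maximum with a constant is 1-Lipschitz, hence preserves Cauchy sequences; this is what makes `⅓⊔`
-- a real.
∣⊔-⊔∣≤∣-∣ : ∀ p q r → ℚ.∣ (p ℚ.⊔ q) ℚ.- (p ℚ.⊔ r) ∣ ℚ.≤ ℚ.∣ q ℚ.- r ∣
∣⊔-⊔∣≤∣-∣ p q r = ∣p-q∣-lub (⊔-monoʳ-+∣-∣ p q r)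
  (subst (λ d → p ℚ.⊔ r ℚ.≤ (p ℚ.⊔ q) ℚ.+ d) (∣p-q∣≡∣q-p∣ r q) (⊔-monoʳ-+∣-∣ p r q))

q≤q+ε : ∀ q {ε} → 0ℚ ℚ.< ε → q ℚ.≤ q ℚ.+ ε
q≤q+ε q {ε} 0<ε = subst (ℚ._≤ q ℚ.+ ε) (ℚ.+-identityʳ q) (ℚ.+-monoʳ-≤ q (ℚ.<⇒≤ 0<ε))

half+half : ∀ ε → ½ ℚ.* ε ℚ.+ ½ ℚ.* ε ≡ ε
half+half ε = trans (sym (ℚ.*-distribʳ-+ ε ½ ½)) (ℚ.*-identityˡ ε)

-- Equality and order of reals

infix 4 _≈_ _≼_

-- Termwise equality, finer than equality of reals, already contains every
-- algebraic identity between expectations.  Unlike equality of reals, it is a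
-- congruence for _*_ without any appeal to boundedness.
record _≈_ (x y : ℝ) : Set where
  constructor termwise
  field at : ∀ n → seq x n ≡ seq y n

-- Unlike x ≤ y, the type x ≼ y determines x and y by unification.
record _≼_ (x y : ℝ) : Set where
  constructor wrap
  field unwrap : x ≤ y

open _≈_
open _≼_

≈-refl : ∀ {x} → x ≈ x
≈-refl = termwise λ n → refl

≈-sym : ∀ {x y} → x ≈ y → y ≈ x
≈-sym p = termwise λ n → sym (at p n)

≈-trans : ∀ {x y z} → x ≈ y → y ≈ z → x ≈ z
≈-trans p q = termwise λ n → trans (at p n) (at q n)

≡⇒≈ : ∀ {x y} → x ≡ y → x ≈ y
≡⇒≈ refl = ≈-refl

≤-termwise : ∀ {x y} → (∀ n → seq x n ℚ.≤ seq y n) → x ≼ y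
≤-termwise {x} {y} h = wrap λ ε 0<ε → 0 , λ n _ → ℚ.≤-trans (h n) (q≤q+ε (seq y n) 0<ε)

≼-reflexive : ∀ {x y} → x ≈ y → x ≼ y
≼-reflexive p = ≤-termwise λ n → ℚ.≤-reflexive (at p n)

≼-refl : ∀ {x} → x ≼ x
≼-refl = ≼-reflexive ≈-refl

≼-trans : ∀ {x y z} → x ≼ y → y ≼ z → x ≼ z
≼-trans {x} {y} {z} (wrap p) (wrap q) = wrap λ ε 0<ε →
  let 0<ε/2   = half-pos 0<ε
      (M , h) = p (½ ℚ.* ε) 0<ε/2
      (N , k) = q (½ ℚ.* ε) 0<ε/2
  in M ℕ.⊔ N , λ n b → begin
    seq x n                               ≤⟨ h n (ℕ.m⊔n≤o⇒m≤o M N b) ⟩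
    seq y n ℚ.+ ½ ℚ.* ε                   ≤⟨ ℚ.+-monoˡ-≤ (½ ℚ.* ε) (k n (ℕ.m⊔n≤o⇒n≤o M N b)) ⟩
    seq z n ℚ.+ ½ ℚ.* ε ℚ.+ ½ ℚ.* ε       ≡⟨ ℚ.+-assoc (seq z n) _ _ ⟩
    seq z n ℚ.+ (½ ℚ.* ε ℚ.+ ½ ℚ.* ε)     ≡⟨ cong (seq z n ℚ.+_) (half+half ε) ⟩
    seq z n ℚ.+ ε                         ∎
  where open ℚ.≤-Reasoning

≼-preorder : Preorder _ _ _
≼-preorder = record
  { Carrier = ℝ ; _≈_ = _≈_ ; _≲_ = _≼_
  ; isPreorder = record
    { isEquivalence = record { refl = ≈-refl ; sym = ≈-sym ; trans = ≈-trans }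
    ; reflexive = ≼-reflexive
    ; trans = ≼-trans } }

open import Relation.Binary.Reasoning.Preorder ≼-preorder

+-cong : ∀ {x y u v} → x ≈ y → u ≈ v → x + u ≈ y + v
+-cong p q = termwise λ n → cong₂ ℚ._+_ (at p n) (at q n)

*-cong : ∀ {x y u v} → x ≈ y → u ≈ v → x * u ≈ y * v
*-cong p q = termwise λ n → cong₂ ℚ._*_ (at p n) (at q n)

*-congˡ : ∀ {x u v} → u ≈ v → x * u ≈ x * v
*-congˡ = *-cong ≈-refl

+-identityˡ : ∀ x → 0ℝ + x ≈ x
+-identityˡ x = termwise λ n → ℚ.+-identityˡ (seq x n)

+-identityʳ : ∀ x → x + 0ℝ ≈ x
+-identityʳ x = termwise λ n → ℚ.+-identityʳ (seq x n)

+-assoc : ∀ x y z → (x + y) + z ≈ x + (y + z)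
+-assoc x y z = termwise λ n → ℚ.+-assoc (seq x n) (seq y n) (seq z n)

*-identityˡ : ∀ x → 1ℝ * x ≈ x
*-identityˡ x = termwise λ n → ℚ.*-identityˡ (seq x n)

*-identityʳ : ∀ x → x * 1ℝ ≈ x
*-identityʳ x = termwise λ n → ℚ.*-identityʳ (seq x n)

*-zeroˡ : ∀ x → 0ℝ * x ≈ 0ℝ
*-zeroˡ x = termwise λ n → ℚ.*-zeroˡ (seq x n)

*-zeroʳ : ∀ x → x * 0ℝ ≈ 0ℝ
*-zeroʳ x = termwise λ n → ℚ.*-zeroʳ (seq x n)

*-assoc : ∀ x y z → (x * y) * z ≈ x * (y * z)
*-assoc x y z = termwise λ n → ℚ.*-assoc (seq x n) (seq y n) (seq z n)

*-comm : ∀ x y → x * y ≈ y * x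
*-comm x y = termwise λ n → ℚ.*-comm (seq x n) (seq y n)

*-distribˡ-+ : ∀ x y z → x * (y + z) ≈ x * y + x * z
*-distribˡ-+ x y z = termwise λ n → ℚ.*-distribˡ-+ (seq x n) (seq y n) (seq z n)

+-interchange : ∀ x y u v → (x + y) + (u + v) ≈ (x + u) + (y + v)
+-interchange x y u v = termwise λ n →
  solve 4 (λ x y u v → (x :+ y) :+ (u :+ v) := (x :+ u) :+ (y :+ v)) refl
    (seq x n) (seq y n) (seq u n) (seq v n)

*-swapˡ : ∀ x y z → x * (y * z) ≈ y * (x * z)
*-swapˡ x y z = termwise λ n →
  solve 3 (λ x y z → x :* (y :* z) := y :* (x :* z)) refl (seq x n) (seq y n) (seq z n)

x+[y-x]≈y : ∀ x y → x + (y - x) ≈ y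
x+[y-x]≈y x y = termwise λ n → solve 2 (λ x y → x :+ (y :- x) := y) refl (seq x n) (seq y n)

+-mono-≼ : ∀ {x y u v} → x ≼ y → u ≼ v → x + u ≼ y + v
+-mono-≼ {x} {y} {u} {v} (wrap p) (wrap q) = wrap λ ε 0<ε →
  let 0<ε/2   = half-pos 0<ε
      (M , h) = p (½ ℚ.* ε) 0<ε/2
      (N , k) = q (½ ℚ.* ε) 0<ε/2
      δ       = ½ ℚ.* ε
  in M ℕ.⊔ N , λ n b → subst (seq x n ℚ.+ seq u n ℚ.≤_)
    (trans (solve 3 (λ y v d → (y :+ d) :+ (v :+ d) := (y :+ v) :+ (d :+ d)) refl
             (seq y n) (seq v n) δ)
      (cong (seq y n ℚ.+ seq v n ℚ.+_) (half+half ε)))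
    (ℚ.+-mono-≤ (h n (ℕ.m⊔n≤o⇒m≤o M N b)) (k n (ℕ.m⊔n≤o⇒n≤o M N b)))

0≼x+y : ∀ {x y} → 0ℝ ≼ x → 0ℝ ≼ y → 0ℝ ≼ x + y
0≼x+y p q = ≼-trans (≼-reflexive (≈-sym (+-identityˡ 0ℝ))) (+-mono-≼ p q)

x≼x+y : ∀ {x y} → 0ℝ ≼ y → x ≼ x + y
x≼x+y {x} p = ≼-trans (≼-reflexive (≈-sym (+-identityʳ x))) (+-mono-≼ ≼-refl p)

y≼x+y : ∀ {x y} → 0ℝ ≼ x → y ≼ x + y
y≼x+y {y = y} p = ≼-trans (≼-reflexive (≈-sym (+-identityˡ y))) (+-mono-≼ p ≼-refl)

0≼y-x : ∀ {x y} → x ≼ y → 0ℝ ≼ y - x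
0≼y-x {x} {y} p = begin
  0ℝ        ≈⟨ termwise (λ n → sym (ℚ.+-inverseʳ (seq x n))) ⟩
  x - x     ∼⟨ +-mono-≼ p ≼-refl ⟩
  y - x     ∎

-- With a , b ≥ -δ, expand 0 ≤ (a + δ)(b + δ).
0≤-*-approx : ∀ {a b A B δ η} → 0ℚ ℚ.≤ δ → 0ℚ ℚ.≤ a ℚ.+ δ → 0ℚ ℚ.≤ b ℚ.+ δ →
  a ℚ.≤ A → b ℚ.≤ B → δ ℚ.≤ 1ℚ → δ ℚ.≤ η → 0ℚ ℚ.≤ (A ℚ.+ B) ℚ.+ 1ℚ →
  0ℚ ℚ.≤ a ℚ.* b ℚ.+ ((A ℚ.+ B) ℚ.+ 1ℚ) ℚ.* η
0≤-*-approx {a} {b} {A} {B} {δ} {η} 0≤δ 0≤a+δ 0≤b+δ a≤A b≤B δ≤1 δ≤η 0≤k = ℚR.begin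
  0ℚ
    ℚR.≡⟨ ℚ.*-zeroʳ (a ℚ.+ δ) ⟨
  (a ℚ.+ δ) ℚ.* 0ℚ
    ℚR.≤⟨ ℚ.*-monoˡ-≤-nonNeg (a ℚ.+ δ) {{ℚ.nonNegative 0≤a+δ}} 0≤b+δ ⟩
  (a ℚ.+ δ) ℚ.* (b ℚ.+ δ)
    ℚR.≡⟨ solve 3 (λ a b d → (a :+ d) :* (b :+ d) := a :* b :+ d :* ((a :+ b) :+ d)) refl a b δ ⟩
  a ℚ.* b ℚ.+ δ ℚ.* ((a ℚ.+ b) ℚ.+ δ)
    ℚR.≤⟨ ℚ.+-monoʳ-≤ (a ℚ.* b) (ℚ.*-monoˡ-≤-nonNeg δ {{ℚ.nonNegative 0≤δ}}
           (ℚ.+-mono-≤ (ℚ.+-mono-≤ a≤A b≤B) δ≤1)) ⟩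
  a ℚ.* b ℚ.+ δ ℚ.* ((A ℚ.+ B) ℚ.+ 1ℚ)
    ℚR.≤⟨ ℚ.+-monoʳ-≤ (a ℚ.* b)
           (ℚ.*-monoʳ-≤-nonNeg ((A ℚ.+ B) ℚ.+ 1ℚ) {{ℚ.nonNegative 0≤k}} δ≤η) ⟩
  a ℚ.* b ℚ.+ η ℚ.* ((A ℚ.+ B) ℚ.+ 1ℚ)
    ℚR.≡⟨ cong (a ℚ.* b ℚ.+_) (ℚ.*-comm η _) ⟩
  a ℚ.* b ℚ.+ ((A ℚ.+ B) ℚ.+ 1ℚ) ℚ.* η ℚR.∎
  where module ℚR = ℚ.≤-Reasoning

-- A nonnegative real may have slightly negative terms, so the terms cannot simply be multiplied.
-- The product of two errors is controlled by the bounds that Cauchy sequences eventually satisfy.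
0≼x*y : ∀ {x y} → 0ℝ ≼ x → 0ℝ ≼ y → 0ℝ ≼ x * y
0≼x*y {x} {y} (wrap p) (wrap q) = wrap λ ε 0<ε →
  let (A , K , 0<A , hA) = bounded {seq x} (cauchy x)
      (B , L , 0<B , hB) = bounded {seq y} (cauchy y)
      -- The error terms of the product are δ times a factor at most A + B + δ. Capping δ at 1
      -- bounds that factor by A + B + 1, and η is ε divided by this bound.
      0<k                = ℚ.+-mono-< (ℚ.+-mono-< 0<A 0<B) (ℚ.positive⁻¹ 1ℚ)
      (η , 0<η , eq)     = divide 0<k 0<ε
      δ                  = η ℚ.⊓ 1ℚ
      0<δ                = 0<⊓ 0<η
      (M , h)            = p δ 0<δ
      (N , k)            = q δ 0<δ
  in (K ℕ.⊔ L) ℕ.⊔ (M ℕ.⊔ N) , λ n b →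
    let b₁ = ℕ.m⊔n≤o⇒m≤o (K ℕ.⊔ L) (M ℕ.⊔ N) b
        b₂ = ℕ.m⊔n≤o⇒n≤o (K ℕ.⊔ L) (M ℕ.⊔ N) b
    in subst (λ e → 0ℚ ℚ.≤ seq x n ℚ.* seq y n ℚ.+ e) eq
      (0≤-*-approx {seq x n} {seq y n} {A} {B} {δ} {η} (ℚ.<⇒≤ 0<δ)
        (h n (ℕ.m⊔n≤o⇒m≤o M N b₂)) (k n (ℕ.m⊔n≤o⇒n≤o M N b₂))
        (ℚ.≤-trans (p≤∣p∣ _) (hA n (ℕ.m⊔n≤o⇒m≤o K L b₁)))
        (ℚ.≤-trans (p≤∣p∣ _) (hB n (ℕ.m⊔n≤o⇒n≤o K L b₁)))
        (ℚ.p⊓q≤q η 1ℚ) (ℚ.p⊓q≤p η 1ℚ) (ℚ.<⇒≤ 0<k))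
  where
  0<⊓ : ∀ {η} → 0ℚ ℚ.< η → 0ℚ ℚ.< η ℚ.⊓ 1ℚ
  0<⊓ {η} 0<η with ℚ.⊓-sel η 1ℚ
  ... | inj₁ eq = subst (0ℚ ℚ.<_) (sym eq) 0<η
  ... | inj₂ eq = subst (0ℚ ℚ.<_) (sym eq) (ℚ.positive⁻¹ 1ℚ)

*-monoˡ-≼ : ∀ {x y z} → 0ℝ ≼ z → x ≼ y → z * x ≼ z * y
*-monoˡ-≼ {x} {y} {z} 0≼z p = begin
  z * x                   ∼⟨ x≼x+y (0≼x*y 0≼z (0≼y-x p)) ⟩
  z * x + z * (y - x)     ≈⟨ *-distribˡ-+ z x (y - x) ⟨
  z * (x + (y - x))       ≈⟨ *-congˡ (x+[y-x]≈y x y) ⟩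
  z * y                   ∎

*-monoʳ-≼ : ∀ {x y z} → 0ℝ ≼ z → x ≼ y → x * z ≼ y * z
*-monoʳ-≼ {x} {y} {z} 0≼z p = begin
  x * z   ≈⟨ *-comm x z ⟩
  z * x   ∼⟨ *-monoˡ-≼ 0≼z p ⟩
  z * y   ≈⟨ *-comm z y ⟩
  y * z   ∎

fromℚ-mono : ∀ {p q} → p ℚ.≤ q → fromℚ p ≼ fromℚ q
fromℚ-mono p≤q = ≤-termwise λ _ → p≤q

0≼1 : 0ℝ ≼ 1ℝ
0≼1 = fromℚ-mono (ℚ.<⇒≤ (ℚ.positive⁻¹ 1ℚ))

<-≼-trans : ∀ {x y z} → x < y → y ≼ z → x < z
<-≼-trans {x} {y} {z} (ε , M , 0<ε , h) (wrap p) =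
  -- Half of the gap absorbs the error allowed by `≼`; the other half remains as the new gap.
  let 0<ε/2   = half-pos 0<ε
      (N , k) = p (½ ℚ.* ε) 0<ε/2
      δ       = ½ ℚ.* ε
  in δ , M ℕ.⊔ N , 0<ε/2 , λ n b → +-cancelʳ-≤ δ (ℚ.≤-trans
       (subst (ℚ._≤ seq y n)
         (trans (cong (seq x n ℚ.+_) (sym (half+half ε))) (sym (ℚ.+-assoc (seq x n) δ δ)))
         (h n (ℕ.m⊔n≤o⇒m≤o M N b)))
       (k n (ℕ.m⊔n≤o⇒n≤o M N b)))
  where
  +-cancelʳ-≤ : ∀ r {p q} → p ℚ.+ r ℚ.≤ q ℚ.+ r → p ℚ.≤ q
  +-cancelʳ-≤ r {p} {q} le = subst₂ ℚ._≤_ (cancel p) (cancel q) (ℚ.+-monoˡ-≤ (ℚ.- r) le)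
    where
    cancel : ∀ p → p ℚ.+ r ℚ.- r ≡ p
    cancel p = solve 2 (λ p r → p :+ r :- r := p) refl p r

-- Reciprocals

-- `recip` discards an initial segment, so x and its reciprocal are misaligned termwise. Reindexing
-- x aligns them, and a tail represents the same real.
shift : ℕ.ℕ → ℝ → ℝ
shift N (mkℝ s c) = mkℝ (λ n → s (N ℕ.+ n)) λ ε 0<ε →
  let (M , h) = c ε 0<ε
  in M , λ m n p q → h (N ℕ.+ m) (N ℕ.+ n) (ℕ.m≤n⇒m≤o+n N p) (ℕ.m≤n⇒m≤o+n N q)

cauchy-close : ∀ x ε → 0ℚ ℚ.< ε →
  ∃ λ N → ∀ m n → N ℕ.≤ m → N ℕ.≤ n → seq x m ℚ.≤ seq x n ℚ.+ ε
cauchy-close x ε 0<ε =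
  let (M , h) = cauchy x ε 0<ε
  in M , λ m n p q → ℚ.≤-trans (p≤q+∣p-q∣ (seq x m) (seq x n))
                       (ℚ.+-monoʳ-≤ (seq x n) (ℚ.<⇒≤ (h m n p q)))

shift-≼ : ∀ N x → shift N x ≼ x
shift-≼ N x = wrap λ ε 0<ε →
  let (M , h) = cauchy-close x ε 0<ε
  in M , λ n p → h (N ℕ.+ n) n (ℕ.m≤n⇒m≤o+n N p) p

≼-shift : ∀ N x → x ≼ shift N x
≼-shift N x = wrap λ ε 0<ε →
  let (M , h) = cauchy-close x ε 0<ε
  in M , λ n p → h n (N ℕ.+ n) p (ℕ.m≤n⇒m≤o+n N p)

0≼recip : ∀ x (0<x : 0ℝ < x) → 0ℝ ≼ recip x 0<x
0≼recip x (ε , N , 0<ε , h) = ≤-termwise λ n →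
  let ε≤xₙ = subst (ℚ._≤ seq x (N ℕ.+ n)) (ℚ.+-identityˡ ε) (h (N ℕ.+ n) (ℕ.m≤m+n N n))
  in ℚ.<⇒≤ (ℚ.positive⁻¹ _
       {{ℚ.1/pos⇒pos (seq x (N ℕ.+ n)) {{ℚ.positive (ℚ.<-≤-trans 0<ε ε≤xₙ)}}}})

-- The index stored in the positivity witness is the one at which `recip` starts, so the
-- cancellation is exact in every term.
shift*recip : ∀ x (0<x : 0ℝ < x) → shift (proj₁ (proj₂ 0<x)) x * recip x 0<x ≈ 1ℝ
shift*recip x (ε , N , 0<ε , h) = termwise λ n → ℚ.*-inverseʳ (seq x (N ℕ.+ n)) {{_}}

x*recip≼1 : ∀ x (0<x : 0ℝ < x) → x * recip x 0<x ≼ 1ℝ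
x*recip≼1 x 0<x = begin
  x * recip x 0<x                              ∼⟨ *-monoʳ-≼ (0≼recip x 0<x) (≼-shift _ x) ⟩
  shift (proj₁ (proj₂ 0<x)) x * recip x 0<x    ≈⟨ shift*recip x 0<x ⟩
  1ℝ                                           ∎

1≼x*recip : ∀ x (0<x : 0ℝ < x) → 1ℝ ≼ x * recip x 0<x
1≼x*recip x 0<x = begin
  1ℝ                                           ≈⟨ shift*recip x 0<x ⟨
  shift (proj₁ (proj₂ 0<x)) x * recip x 0<x    ∼⟨ *-monoʳ-≼ (0≼recip x 0<x) (shift-≼ _ x) ⟩
  x * recip x 0<x                              ∎

-- Used to pass from a bound on a joint probability to one on a conditional probability, which
-- `ℙ-given` defines as a product with `recip`.
c≼x*recip : ∀ {c x y} (0<y : 0ℝ < y) → 0ℝ ≼ c → c * y ≼ x → c ≼ x * recip y 0<y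
c≼x*recip {c} {x} {y} 0<y 0≼c c*y≼x = begin
  c                       ≈⟨ *-identityʳ c ⟨
  c * 1ℝ                  ∼⟨ *-monoˡ-≼ 0≼c (1≼x*recip y 0<y) ⟩
  c * (y * recip y 0<y)   ≈⟨ *-assoc c y (recip y 0<y) ⟨
  (c * y) * recip y 0<y   ∼⟨ *-monoʳ-≼ (0≼recip y 0<y) c*y≼x ⟩
  x * recip y 0<y         ∎

-- The attenuation factor

0≼⅓ : 0ℝ ≼ ⅓
0≼⅓ = fromℚ-mono (ℚ.<⇒≤ (ℚ.positive⁻¹ (ℤ.+ 1 ℚ./ 3)))

⅓⊔ : ℝ → ℝ
⅓⊔ (mkℝ s c) = mkℝ (λ n → (ℤ.+ 1 ℚ./ 3) ℚ.⊔ s n) λ ε 0<ε →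
  let (N , h) = c ε 0<ε
  in N , λ m n p q → ℚ.≤-<-trans (∣⊔-⊔∣≤∣-∣ (ℤ.+ 1 ℚ./ 3) (s m) (s n)) (h m n p q)

⅓≼⅓⊔ : ∀ x → ⅓ ≼ ⅓⊔ x
⅓≼⅓⊔ x = ≤-termwise λ n → ℚ.p≤p⊔q (ℤ.+ 1 ℚ./ 3) (seq x n)

x≼⅓⊔x : ∀ x → x ≼ ⅓⊔ x
x≼⅓⊔x x = ≤-termwise λ n → ℚ.p≤q⊔p (ℤ.+ 1 ℚ./ 3) (seq x n)

⅓⊔x≼x : ∀ {x} → ⅓ ≼ x → ⅓⊔ x ≼ x
⅓⊔x≼x {x} (wrap p) = wrap λ ε 0<ε →
  let (N , h) = p ε 0<ε
  in N , λ n b → ℚ.⊔-lub (h n b) (q≤q+ε (seq x n) 0<ε)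

0<⅓⊔ : ∀ x → 0ℝ < ⅓⊔ x
0<⅓⊔ x = (ℤ.+ 1 ℚ./ 3) , 0 , ℚ.positive⁻¹ _ , λ n _ →
  subst (ℚ._≤ seq (⅓⊔ x) n) (sym (ℚ.+-identityˡ _)) (ℚ.p≤p⊔q (ℤ.+ 1 ℚ./ 3) (seq x n))

opaque
  attenuate : ℝ → Probability
  attenuate x = record
    { value = ⅓ * recip (⅓⊔ x) (0<⅓⊔ x)
    ; 0≤v   = unwrap (0≼x*y 0≼⅓ (0≼recip (⅓⊔ x) (0<⅓⊔ x)))
    ; v≤1   = unwrap (begin
        ⅓ * recip (⅓⊔ x) (0<⅓⊔ x)       ∼⟨ *-monoʳ-≼ (0≼recip (⅓⊔ x) (0<⅓⊔ x)) (⅓≼⅓⊔ x) ⟩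
        ⅓⊔ x * recip (⅓⊔ x) (0<⅓⊔ x)    ∼⟨ x*recip≼1 (⅓⊔ x) (0<⅓⊔ x) ⟩
        1ℝ                              ∎) }

factor : ℝ → ℝ
factor x = Probability.value (attenuate x)

0≼factor : ∀ x → 0ℝ ≼ factor x
0≼factor x = wrap (Probability.0≤v (attenuate x))

opaque
  unfolding attenuate

  factor*⅓⊔ : ∀ x → factor x * ⅓⊔ x ≈ ⅓ * (⅓⊔ x * recip (⅓⊔ x) (0<⅓⊔ x))
  factor*⅓⊔ x = ≈-trans (*-assoc ⅓ _ _) (*-congˡ {⅓} (*-comm (recip (⅓⊔ x) (0<⅓⊔ x)) (⅓⊔ x)))

-- Dividing by `⅓⊔ x`, which is at least x, can only lower the factor, so the bound survives at
-- reals below 1/3.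
factor*x≼⅓ : ∀ x → factor x * x ≼ ⅓
factor*x≼⅓ x = begin
  factor x * x                               ∼⟨ *-monoˡ-≼ (0≼factor x) (x≼⅓⊔x x) ⟩
  factor x * ⅓⊔ x                            ≈⟨ factor*⅓⊔ x ⟩
  ⅓ * (⅓⊔ x * recip (⅓⊔ x) (0<⅓⊔ x))         ∼⟨ *-monoˡ-≼ 0≼⅓ (x*recip≼1 (⅓⊔ x) (0<⅓⊔ x)) ⟩
  ⅓ * 1ℝ                                     ≈⟨ *-identityʳ ⅓ ⟩
  ⅓                                          ∎

⅓≼factor*x : ∀ {x} → ⅓ ≼ x → ⅓ ≼ factor x * x
⅓≼factor*x {x} ⅓≼x = begin
  ⅓                                          ≈⟨ *-identityʳ ⅓ ⟨
  ⅓ * 1ℝ                                     ∼⟨ *-monoˡ-≼ 0≼⅓ (1≼x*recip (⅓⊔ x) (0<⅓⊔ x)) ⟩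
  ⅓ * (⅓⊔ x * recip (⅓⊔ x) (0<⅓⊔ x))         ≈⟨ factor*⅓⊔ x ⟨
  factor x * ⅓⊔ x                            ∼⟨ *-monoˡ-≼ (0≼factor x) (⅓⊔x≼x ⅓≼x) ⟩
  factor x * x                               ∎

private variable
  A B : Set

-- Finite sums

∑-cong : {f g : A → ℝ} → (∀ a → f a ≈ g a) → ∀ l → ∑ (map f l) ≈ ∑ (map g l)
∑-cong h []      = ≈-refl
∑-cong h (a ∷ l) = +-cong (h a) (∑-cong h l)

∑-mono : {f g : A → ℝ} → (∀ a → f a ≼ g a) → ∀ l → ∑ (map f l) ≼ ∑ (map g l)
∑-mono h []      = ≼-refl
∑-mono h (a ∷ l) = +-mono-≼ (h a) (∑-mono h l)

∑-0≼ : {f : A → ℝ} → (∀ a → 0ℝ ≼ f a) → ∀ l → 0ℝ ≼ ∑ (map f l)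
∑-0≼ h []      = ≼-refl
∑-0≼ h (a ∷ l) = 0≼x+y (h a) (∑-0≼ h l)

term≼∑ : {f : A → ℝ} → (∀ a → 0ℝ ≼ f a) → ∀ {a l} → a List.∈ l → f a ≼ ∑ (map f l)
term≼∑ h {l = _ ∷ l} (here refl) = x≼x+y (∑-0≼ h l)
term≼∑ h (there a∈l) = ≼-trans (term≼∑ h a∈l) (y≼x+y (h _))

∑-*ˡ : ∀ c {f : A → ℝ} l → ∑ (map (λ a → c * f a) l) ≈ c * ∑ (map f l)
∑-*ˡ c         []      = ≈-sym (*-zeroʳ c)
∑-*ˡ c {f} (a ∷ l) = begin-equality
  c * f a + ∑ (map (λ a → c * f a) l)    ≈⟨ +-cong ≈-refl (∑-*ˡ c l) ⟩
  c * f a + c * ∑ (map f l)              ≈⟨ *-distribˡ-+ c _ _ ⟨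
  c * (f a + ∑ (map f l))                ∎

-- Expectations

⟦_⟧ : Bool → ℝ
⟦ true  ⟧ = 1ℝ
⟦ false ⟧ = 0ℝ

0≼⟦⟧ : ∀ b → 0ℝ ≼ ⟦ b ⟧
0≼⟦⟧ true  = 0≼1
0≼⟦⟧ false = ≼-refl

-- Nonnegative weights are carried along because monotonicity of the expectation rests on them.
-- Every listed outcome counts, even one of weight zero, in accordance with the form of
-- `selectsMatching`.
Supported : (A → Set) → Dist A → Set
Supported P = All (λ (w , a) → 0ℝ ≼ w × P a)

supported-map : {P Q : A → Set} → (∀ {a} → P a → Q a) → ∀ {d} → Supported P d → Supported Q d
supported-map h = All.map (map₂ h)

supported-pure : {P : A → Set} {a : A} → P a → Supported P (pure a)
supported-pure p = (0≼1 , p) ∷ []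

supported->>= : {P : A → Set} {Q : B → Set} (d : Dist A) (f : A → Dist B) →
  Supported P d → (∀ a → P a → Supported Q (f a)) → Supported Q (d >>= f)
supported->>= []            f []              h = []
supported->>= ((w , a) ∷ d) f ((0≼w , p) ∷ s) h =
  All.++⁺ (All.map⁺ (All.map (λ (0≼v , q) → 0≼x*y 0≼w 0≼v , q) (h a p))) (supported->>= d f s h)

opaque
  -- As a functional, the expectation turns `>>=` into nesting, which keeps the lists of outcomes
  -- out of the analysis. Events enter through `⟦_⟧`.
  𝔼 : Dist A → (A → ℝ) → ℝ
  𝔼 d f = ∑ (map (λ (w , a) → w * f a) d)

  ℙ≈𝔼 : ∀ (d : Dist A) {P : Pred A 0ℓ} (P? : Decidable P) → ℙ d P? ≈ 𝔼 d (λ a → ⟦ does (P? a) ⟧)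
  ℙ≈𝔼 []            P? = ≈-refl
  ℙ≈𝔼 ((w , a) ∷ d) P? with does (P? a)
  ... | true  = +-cong (≈-sym (*-identityʳ w)) (ℙ≈𝔼 d P?)
  ... | false = begin-equality
    ℙ d P?           ≈⟨ ℙ≈𝔼 d P? ⟩
    𝔼 d _            ≈⟨ +-identityˡ _ ⟨
    0ℝ + 𝔼 d _       ≈⟨ +-cong (*-zeroʳ w) ≈-refl ⟨
    w * 0ℝ + 𝔼 d _   ∎

  𝔼-congˢ : {P : A → Set} {d : Dist A} {f g : A → ℝ} →
    Supported P d → (∀ a → P a → f a ≈ g a) → 𝔼 d f ≈ 𝔼 d g
  𝔼-congˢ []            h = ≈-refl
  𝔼-congˢ ((_ , p) ∷ s) h = +-cong (*-congˡ (h _ p)) (𝔼-congˢ s h)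

  𝔼-monoˢ : {P : A → Set} {d : Dist A} {f g : A → ℝ} →
    Supported P d → (∀ a → P a → f a ≼ g a) → 𝔼 d f ≼ 𝔼 d g
  𝔼-monoˢ []              h = ≼-refl
  𝔼-monoˢ ((0≼w , p) ∷ s) h = +-mono-≼ (*-monoˡ-≼ 0≼w (h _ p)) (𝔼-monoˢ s h)

  𝔼-cong : (d : Dist A) {f g : A → ℝ} → (∀ a → f a ≈ g a) → 𝔼 d f ≈ 𝔼 d g
  𝔼-cong d h = ∑-cong (λ (w , a) → *-congˡ (h a)) d

  𝔼-*ˡ : ∀ c (d : Dist A) {f : A → ℝ} → 𝔼 d (λ a → c * f a) ≈ c * 𝔼 d f
  𝔼-*ˡ c d {f} = begin-equality
    ∑ (map (λ (w , a) → w * (c * f a)) d)   ≈⟨ ∑-cong (λ (w , a) → *-swapˡ w c (f a)) d ⟩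
    ∑ (map (λ (w , a) → c * (w * f a)) d)   ≈⟨ ∑-*ˡ c d ⟩
    c * 𝔼 d f                               ∎

  𝔼-+ : (d : Dist A) {f g : A → ℝ} → 𝔼 d (λ a → f a + g a) ≈ 𝔼 d f + 𝔼 d g
  𝔼-+ []                    = ≈-sym (+-identityˡ 0ℝ)
  𝔼-+ ((w , a) ∷ d) {f} {g} = begin-equality
    w * (f a + g a) + 𝔼 d (λ a → f a + g a)       ≈⟨ +-cong (*-distribˡ-+ w (f a) (g a)) (𝔼-+ d) ⟩
    (w * f a + w * g a) + (𝔼 d f + 𝔼 d g)         ≈⟨ +-interchange _ _ _ _ ⟩
    (w * f a + 𝔼 d f) + (w * g a + 𝔼 d g)         ∎

  𝔼-0 : (d : Dist A) → 𝔼 d (λ _ → 0ℝ) ≈ 0ℝ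
  𝔼-0 []            = ≈-refl
  𝔼-0 ((w , _) ∷ d) = ≈-trans (+-cong (*-zeroʳ w) (𝔼-0 d)) (+-identityˡ 0ℝ)

  𝔼-∑ : (d : Dist A) {f : B → A → ℝ} (l : List B) →
    𝔼 d (λ a → ∑ (map (λ b → f b a) l)) ≈ ∑ (map (λ b → 𝔼 d (f b)) l)
  𝔼-∑ d []      = 𝔼-0 d
  𝔼-∑ d (b ∷ l) = ≈-trans (𝔼-+ d) (+-cong ≈-refl (𝔼-∑ d l))

  𝔼-pure : (a : A) (f : A → ℝ) → 𝔼 (pure a) f ≈ f a
  𝔼-pure a f = ≈-trans (+-identityʳ _) (*-identityˡ (f a))

  𝔼-++ : (d d′ : Dist A) {f : A → ℝ} → 𝔼 (d ++ d′) f ≈ 𝔼 d f + 𝔼 d′ f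
  𝔼-++ []            d′ = ≈-sym (+-identityˡ _)
  𝔼-++ ((w , a) ∷ d) d′ = ≈-trans (+-cong ≈-refl (𝔼-++ d d′)) (≈-sym (+-assoc _ _ _))

  𝔼-scale : ∀ w (d : Dist A) {f : A → ℝ} → 𝔼 (map (λ (v , a) → w * v , a) d) f ≈ w * 𝔼 d f
  𝔼-scale w []            = ≈-sym (*-zeroʳ w)
  𝔼-scale w ((v , a) ∷ d) =
    ≈-trans (+-cong (*-assoc w v _) (𝔼-scale w d)) (≈-sym (*-distribˡ-+ w _ _))

  𝔼->>= : (d : Dist A) (f : A → Dist B) {g : B → ℝ} → 𝔼 (d >>= f) g ≈ 𝔼 d (λ a → 𝔼 (f a) g)
  𝔼->>= []            f = ≈-refl
  𝔼->>= ((w , a) ∷ d) f = ≈-trans (𝔼-++ (map _ (f a)) (d >>= f)) (+-cong (𝔼-scale w (f a)) (𝔼->>= d f))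

  𝔼-bernoulli : ∀ p (f : Bool → ℝ) → 𝔼 (bernoulli p) f ≈ p * f true + (1ℝ - p) * f false
  𝔼-bernoulli p f = +-cong ≈-refl (+-identityʳ _)

-- Testing every constant instead of 1 alone allows any quantity independent of the outcome to be
-- integrated out in one step.
HasMass1 : Dist A → Set
HasMass1 d = ∀ c → 𝔼 d (λ _ → c) ≈ c

mass-pure : (a : A) → HasMass1 (pure a)
mass-pure a c = 𝔼-pure a (λ _ → c)

mass->>= : (d : Dist A) (f : A → Dist B) → HasMass1 d → (∀ a → HasMass1 (f a)) → HasMass1 (d >>= f)
mass->>= d f m n c = ≈-trans (𝔼->>= d f) (≈-trans (𝔼-cong d (λ a → n a c)) (m c))

p*c+[1-p]*c≈c : ∀ p c → p * c + (1ℝ - p) * c ≈ c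
p*c+[1-p]*c≈c p c = termwise λ n →
  solve 2 (λ p c → p :* c :+ (con 1ℚ :- p) :* c := c) refl (seq p n) (seq c n)

mass-bernoulli : ∀ p → HasMass1 (bernoulli p)
mass-bernoulli p c = ≈-trans (𝔼-bernoulli p (λ _ → c)) (p*c+[1-p]*c≈c p c)

supported-bernoulli : ∀ {p} → 0ℝ ≼ p → p ≼ 1ℝ → {P : Bool → Set} → (∀ b → P b) →
  Supported P (bernoulli p)
supported-bernoulli 0≼p p≼1 h = (0≼p , h true) ∷ (0≼y-x p≼1 , h false) ∷ []

-- The random set

extend : ∀ {m} → (Fin m → ℝ) → Bool → Dist (Subset (ℕ.suc m))
extend x b = randomSubset x >>= λ R → pure (b ∷ R)

mass-randomSubset : ∀ {m} (x : Fin m → ℝ) → HasMass1 (randomSubset x)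
mass-randomSubset {ℕ.zero}  x = mass-pure {A = Subset 0} []
mass-randomSubset {ℕ.suc m} x =
  mass->>= (bernoulli (x zero)) (extend (x ∘ suc)) (mass-bernoulli (x zero)) λ b →
  mass->>= (randomSubset (x ∘ suc)) (λ R → pure (b ∷ R)) (mass-randomSubset (x ∘ suc)) λ R →
  mass-pure (b ∷ R)

supported-randomSubset : ∀ {m} {x : Fin m → ℝ} → (∀ e → 0ℝ ≼ x e) → (∀ e → x e ≼ 1ℝ) →
  Supported (λ _ → ⊤) (randomSubset x)
supported-randomSubset {ℕ.zero}      p q = supported-pure tt
supported-randomSubset {ℕ.suc m} {x} p q =
  supported->>= (bernoulli (x zero)) (extend (x ∘ suc))
    (supported-bernoulli (p zero) (q zero) λ _ → tt) λ b _ →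
  supported->>= (randomSubset (x ∘ suc)) (λ R → pure (b ∷ R))
    (supported-randomSubset (p ∘ suc) (q ∘ suc)) λ R _ → supported-pure tt

𝔼-randomSubset-suc : ∀ {m} (x : Fin (ℕ.suc m) → ℝ) (f : Subset (ℕ.suc m) → ℝ) →
  𝔼 (randomSubset x) f ≈
    x zero * 𝔼 (randomSubset (x ∘ suc)) (f ∘ (true ∷_)) +
    (1ℝ - x zero) * 𝔼 (randomSubset (x ∘ suc)) (f ∘ (false ∷_))
𝔼-randomSubset-suc x f = begin-equality
  𝔼 (randomSubset x) f
    ≈⟨ 𝔼->>= (bernoulli (x zero)) (extend (x ∘ suc)) ⟩
  𝔼 (bernoulli (x zero)) (λ b → 𝔼 (extend (x ∘ suc) b) f)
    ≈⟨ 𝔼-bernoulli (x zero) (λ b → 𝔼 (extend (x ∘ suc) b) f) ⟩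
  x zero * 𝔼 (extend (x ∘ suc) true) f + (1ℝ - x zero) * 𝔼 (extend (x ∘ suc) false) f
    ≈⟨ +-cong (*-congˡ (tail true)) (*-congˡ (tail false)) ⟩
  x zero * 𝔼 (randomSubset (x ∘ suc)) (f ∘ (true ∷_)) +
  (1ℝ - x zero) * 𝔼 (randomSubset (x ∘ suc)) (f ∘ (false ∷_)) ∎
  where
  tail : ∀ b → 𝔼 (extend (x ∘ suc) b) f ≈ 𝔼 (randomSubset (x ∘ suc)) (f ∘ (b ∷_))
  tail b = ≈-trans (𝔼->>= (randomSubset (x ∘ suc)) (λ R → pure (b ∷ R)))
    (𝔼-cong (randomSubset (x ∘ suc)) λ R → 𝔼-pure (b ∷ R) f)

-- Independence of the event that e is active from any quantity that ignores it. Ignoring the bit of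
-- e is expressed as invariance under overwriting it.
randomSubset-indep : ∀ {m} (x : Fin m → ℝ) e (f : Subset m → ℝ) →
  (∀ R b → f (R [ e ]≔ b) ≈ f R) →
  𝔼 (randomSubset x) (λ R → ⟦ does (e ∈? R) ⟧ * f R) ≈ x e * 𝔼 (randomSubset x) f
randomSubset-indep x zero f inv = begin-equality
  𝔼 (randomSubset x) (λ R → ⟦ does (zero ∈? R) ⟧ * f R)
    ≈⟨ 𝔼-randomSubset-suc x _ ⟩
  x zero * 𝔼 tail (λ R → 1ℝ * f (true ∷ R)) + (1ℝ - x zero) * 𝔼 tail (λ R → 0ℝ * f (false ∷ R))
    ≈⟨ +-cong (*-congˡ (𝔼-cong tail λ R → *-identityˡ _))
              (*-congˡ (≈-trans (𝔼-cong tail λ R → *-zeroˡ _) (𝔼-0 tail))) ⟩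
  x zero * 𝔼 tail (f ∘ (true ∷_)) + (1ℝ - x zero) * 0ℝ
    ≈⟨ ≈-trans (+-cong ≈-refl (*-zeroʳ _)) (+-identityʳ _) ⟩
  x zero * 𝔼 tail (f ∘ (true ∷_))
    -- The coin of the first element is put back as a trivial mixture; invariance then replaces
    -- `true` by `false` in the second branch.
    ≈⟨ *-congˡ (p*c+[1-p]*c≈c (x zero) _) ⟨
  x zero * (x zero * 𝔼 tail (f ∘ (true ∷_)) + (1ℝ - x zero) * 𝔼 tail (f ∘ (true ∷_)))
    ≈⟨ *-congˡ (+-cong ≈-refl (*-congˡ (𝔼-cong tail λ R → inv (false ∷ R) true))) ⟩
  x zero * (x zero * 𝔼 tail (f ∘ (true ∷_)) + (1ℝ - x zero) * 𝔼 tail (f ∘ (false ∷_)))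
    ≈⟨ *-congˡ (𝔼-randomSubset-suc x f) ⟨
  x zero * 𝔼 (randomSubset x) f ∎
  where tail = randomSubset (x ∘ suc)
randomSubset-indep x (suc e) f inv = begin-equality
  𝔼 (randomSubset x) (λ R → ⟦ does (suc e ∈? R) ⟧ * f R)
    ≈⟨ 𝔼-randomSubset-suc x _ ⟩
  x zero * 𝔼 tail (λ R → ⟦ does (e ∈? R) ⟧ * f (true ∷ R)) +
  (1ℝ - x zero) * 𝔼 tail (λ R → ⟦ does (e ∈? R) ⟧ * f (false ∷ R))
    ≈⟨ +-cong (*-congˡ (IH true)) (*-congˡ (IH false)) ⟩
  x zero * (x (suc e) * 𝔼 tail (f ∘ (true ∷_))) +
  (1ℝ - x zero) * (x (suc e) * 𝔼 tail (f ∘ (false ∷_)))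
    ≈⟨ ≈-trans (+-cong (*-swapˡ _ _ _) (*-swapˡ _ _ _)) (≈-sym (*-distribˡ-+ _ _ _)) ⟩
  x (suc e) * (x zero * 𝔼 tail (f ∘ (true ∷_)) + (1ℝ - x zero) * 𝔼 tail (f ∘ (false ∷_)))
    ≈⟨ *-congˡ (𝔼-randomSubset-suc x f) ⟨
  x (suc e) * 𝔼 (randomSubset x) f ∎
  where
  tail = randomSubset (x ∘ suc)
  IH : ∀ b → 𝔼 tail (λ R → ⟦ does (e ∈? R) ⟧ * f (b ∷ R)) ≈ x (suc e) * 𝔼 tail (f ∘ (b ∷_))
  IH b = randomSubset-indep (x ∘ suc) e (f ∘ (b ∷_)) λ R c → inv (b ∷ R) c

∈?-[]≔ : ∀ {m} {e f : Fin m} → f ≢ e → ∀ R b → does (f ∈? R [ e ]≔ b) ≡ does (f ∈? R)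
∈?-[]≔ {e = e} {f} f≢e R b = does-⇔ (mk⇔ undo ([]≔-minimal R f e f≢e)) (f ∈? R [ e ]≔ b) (f ∈? R)
  where
  undo : f ∈ R [ e ]≔ b → f ∈ R
  -- Writing the original bit of e back restores R, so this direction is again an overwrite at a
  -- position other than f.
  undo h = subst (f ∈_) (trans ([]≔-idempotent R e) ([]≔-lookup R e))
    ([]≔-minimal (R [ e ]≔ b) f e f≢e h)

-- The guarded coin toss behind a decision

if-supported : {C D : Set} (c? : Dec C) (d? : Dec D) (p : Probability) →
  Supported (λ b → b ≡ true → C × D)
    (if does c? ∧ does d? then bernoulli (Probability.value p) else pure false)
if-supported (yes c) (yes d) p =
  supported-bernoulli (wrap (Probability.0≤v p)) (wrap (Probability.v≤1 p)) λ _ _ → c , d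
if-supported (yes _) (no _)  p = supported-pure λ ()
if-supported (no _)  _       p = supported-pure λ ()

mass-if : ∀ c p → HasMass1 (if c then bernoulli p else pure false)
mass-if true  p = mass-bernoulli p
mass-if false p = mass-pure false

-- Factored so that activity c stands outside, where independence can split it off, and only d
-- depends on the earlier history.
𝔼-if : ∀ c d p →
  𝔼 (if c ∧ d then bernoulli p else pure false) ⟦_⟧ ≈ ⟦ c ⟧ * (p * ⟦ d ⟧)
𝔼-if true true p = begin-equality
  𝔼 (bernoulli p) ⟦_⟧          ≈⟨ 𝔼-bernoulli p ⟦_⟧ ⟩
  p * 1ℝ + (1ℝ - p) * 0ℝ       ≈⟨ ≈-trans (+-cong ≈-refl (*-zeroʳ (1ℝ - p))) (+-identityʳ _) ⟩
  p * 1ℝ                       ≈⟨ *-identityˡ _ ⟨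
  1ℝ * (p * 1ℝ)                ∎
𝔼-if true false p = begin-equality
  𝔼 (pure false) ⟦_⟧           ≈⟨ 𝔼-pure false ⟦_⟧ ⟩
  0ℝ                           ≈⟨ *-zeroʳ p ⟨
  p * 0ℝ                       ≈⟨ *-identityˡ _ ⟨
  1ℝ * (p * 0ℝ)                ∎
𝔼-if false d p = ≈-trans (𝔼-pure false ⟦_⟧) (≈-sym (*-zeroˡ _))

-- The algorithm and its analysis

module OCRS (G : Graph) (x : Graph.Edge G → ℝ) (x∈𝓕 : Graph.𝓕 G x) where
  open Graph G
  open Online G

  0≼x : ∀ e → 0ℝ ≼ x e
  0≼x e = wrap (proj₁ x∈𝓕 e)

  incidentEdges : Vertex → List Edge
  incidentEdges v = filter (incident? v) edges

  ∈-incidentEdges : ∀ {v e} → Incident v e → e List.∈ incidentEdges v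
  ∈-incidentEdges {v} {e} = ∈-filter⁺ (incident? v) (∈-allFin e)

  x≼1 : ∀ e → x e ≼ 1ℝ
  x≼1 e = ≼-trans (term≼∑ 0≼x (∈-incidentEdges (inj₁ refl))) (wrap (proj₂ x∈𝓕 (end₁ e)))

  mutual
    -- As in a history, the most recent arrival is at the head of ord.
    hist : List Edge → Subset #edges → Dist History
    hist []        R = pure []
    hist (e ∷ ord) R = hist ord R >>= λ h →
      decide (rule ord e) R h e >>= λ d →
      pure (arrival e (does (e ∈? R)) d ∷ h)

    joint : List Edge → Dist History
    joint ord = randomSubset x >>= hist ord

    -- The order is a parameter instead of being read off the history, so the mutual block is
    -- structurally recursive in the order: the coin for `e` involves `joint` only on the strictly
    -- shorter `ord`.
    rule : List Edge → Edge → Algorithm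
    rule ord e _ _ = attenuate (addable ord e)

    addable : List Edge → Edge → ℝ
    addable ord e = 𝔼 (joint ord) λ h → ⟦ does (isMatching? (selection h ∪ ⁅ e ⁆)) ⟧

  -- Of the history only the order is used; observed activity and past decisions are averaged over
  -- inside `addable`. Hence the coin is a deterministic function of the arrivals so far.
  alg : Algorithm
  alg h e = attenuate (addable (map Arrival.edge h) e)

  selected : List Edge → Edge → ℝ
  selected ord f = 𝔼 (joint ord) λ h → ⟦ does (f ∈? selection h) ⟧

  -- Feasibility and total mass

  Valid : Subset #edges → History → Set
  Valid R h = selection h ⊆ R × IsMatching (selection h)

  valid-[] : ∀ {R} → Valid R []
  valid-[] = (λ e∈⊥ → contradiction e∈⊥ ∉⊥) , λ e e∈⊥ → contradiction e∈⊥ ∉⊥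

  valid-∷ : ∀ {R h e b d} → Valid R h →
    (d ≡ true → e ∈ R × IsMatching (selection h ∪ ⁅ e ⁆)) → Valid R (arrival e b d ∷ h)
  valid-∷ {d = false} v _ = v
  valid-∷ {R} {h} {e} {d = true} (I⊆R , _) can = I∪e⊆R , proj₂ (can refl)
    where
    I∪e⊆R : selection h ∪ ⁅ e ⁆ ⊆ R
    I∪e⊆R f∈ with x∈p∪q⁻ (selection h) ⁅ e ⁆ f∈
    ... | inj₁ f∈I = I⊆R f∈I
    ... | inj₂ f∈e = subst (_∈ R) (sym (x∈⁅y⁆⇒x≡y e f∈e)) (proj₁ (can refl))

  decide-supported : ∀ (a : Algorithm) R h e →
    Supported (λ d → d ≡ true → e ∈ R × IsMatching (selection h ∪ ⁅ e ⁆)) (decide a R h e)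
  decide-supported a R h e = if-supported (e ∈? R) (isMatching? (selection h ∪ ⁅ e ⁆)) (a h e)

  decide-cong : ∀ (a b : Algorithm) R h e → a h e ≡ b h e → decide a R h e ≡ decide b R h e
  decide-cong a b R h e = cong λ p →
    if does (e ∈? R) ∧ does (isMatching? (selection h ∪ ⁅ e ⁆))
    then bernoulli (Probability.value p)
    else pure false

  run-supported : ∀ a R es h → Valid R h → Supported (Valid R) (run a R es h)
  run-supported a R []       h v = supported-pure v
  run-supported a R (e ∷ es) h v =
    supported->>= (decide a R h e) (λ d → run a R es (arrival e (does (e ∈? R)) d ∷ h))
      (decide-supported a R h e) λ d can → run-supported a R es _ (valid-∷ v can)

  outcome-supported : ∀ a es →
    Supported (λ (R , I) → I ⊆ R × IsMatching I) (outcome a x es)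
  outcome-supported a es =
    supported->>= (randomSubset x) (λ R → run a R es [] >>= λ h → pure (R , selection h))
      (supported-randomSubset 0≼x x≼1) λ R _ →
    supported->>= (run a R es []) (λ h → pure (R , selection h))
      (run-supported a R es [] valid-[]) λ h v → supported-pure v

  -- The recorded order is what later identifies `alg` with `rule ord` and shows that an edge yet to
  -- arrive is unselected.
  hist-supported : ∀ ord R →
    Supported (λ h → map Arrival.edge h ≡ ord × Valid R h) (hist ord R)
  hist-supported []        R = supported-pure (refl , valid-[])
  hist-supported (e ∷ ord) R =
    supported->>= (hist ord R) _ (hist-supported ord R) λ h (eq , v) →
    supported->>= (decide (rule ord e) R h e) (λ d → pure (arrival e (does (e ∈? R)) d ∷ h))
      (decide-supported (rule ord e) R h e) λ d can →
    supported-pure (cong (e ∷_) eq , valid-∷ v can)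

  mass-decide : ∀ a R h e → HasMass1 (decide a R h e)
  mass-decide a R h e =
    mass-if (does (e ∈? R) ∧ does (isMatching? (selection h ∪ ⁅ e ⁆))) (Probability.value (a h e))

  mass-hist : ∀ ord R → HasMass1 (hist ord R)
  mass-hist []        R = mass-pure {A = History} []
  mass-hist (e ∷ ord) R = mass->>= (hist ord R) _ (mass-hist ord R) λ h →
    mass->>= (decide (rule ord e) R h e) (λ d → pure (arrival e (does (e ∈? R)) d ∷ h))
      (mass-decide (rule ord e) R h e) λ d → mass-pure (arrival e (does (e ∈? R)) d ∷ h)

  joint-supported : ∀ ord →
    Supported (λ h → map Arrival.edge h ≡ ord × IsMatching (selection h)) (joint ord)
  joint-supported ord =
    supported->>= (randomSubset x) (hist ord) (supported-randomSubset 0≼x x≼1) λ R _ →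
    supported-map (λ (eq , _ , m) → eq , m) (hist-supported ord R)

  mass-joint : ∀ ord → HasMass1 (joint ord)
  mass-joint ord = mass->>= (randomSubset x) (hist ord) (mass-randomSubset x) (mass-hist ord)

  -- Expectations along an arrival order

  𝔼-joint : ∀ ord (F : History → ℝ) →
    𝔼 (joint ord) F ≈ 𝔼 (randomSubset x) λ R → 𝔼 (hist ord R) F
  𝔼-joint ord F = 𝔼->>= (randomSubset x) (hist ord)

  𝔼-hist-∷ : ∀ e ord R (F : History → ℝ) → 𝔼 (hist (e ∷ ord) R) F ≈
    𝔼 (hist ord R) λ h → 𝔼 (decide (rule ord e) R h e) λ d →
      F (arrival e (does (e ∈? R)) d ∷ h)
  𝔼-hist-∷ e ord R F = ≈-trans (𝔼->>= (hist ord R) _)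
    (𝔼-cong (hist ord R) λ h →
      ≈-trans (𝔼->>= (decide (rule ord e) R h e) (λ d → pure (arrival e (does (e ∈? R)) d ∷ h)))
        (𝔼-cong (decide (rule ord e) R h e) λ d → 𝔼-pure (arrival e (does (e ∈? R)) d ∷ h) F))

  -- `run` consumes the earliest remaining edge while `hist` peels off the latest one, so the
  -- remaining edges are reversed onto the past. On the support of `hist ord R` the recorded order
  -- is `ord`, and there `alg` and `rule ord e` give `e` the same coin.
  𝔼-run : ∀ es ord R (F : History → ℝ) →
    𝔼 (hist ord R) (λ h → 𝔼 (run alg R es h) F) ≈ 𝔼 (hist (es ʳ++ ord) R) F
  𝔼-run []       ord R F = 𝔼-cong (hist ord R) λ h → 𝔼-pure h F
  𝔼-run (e ∷ es) ord R F = begin-equality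
    𝔼 (hist ord R) (λ h → 𝔼 (run alg R (e ∷ es) h) F)
      ≈⟨ 𝔼-congˢ (hist-supported ord R) (λ h (eq , _) → step h eq) ⟩
    𝔼 (hist ord R) (λ h → 𝔼 (decide (rule ord e) R h e) (rest h))
      ≈⟨ 𝔼-hist-∷ e ord R (λ h → 𝔼 (run alg R es h) F) ⟨
    𝔼 (hist (e ∷ ord) R) (λ h → 𝔼 (run alg R es h) F)
      ≈⟨ 𝔼-run es (e ∷ ord) R F ⟩
    𝔼 (hist (es ʳ++ e ∷ ord) R) F ∎
    where
    rest : History → Bool → ℝ
    rest h d = 𝔼 (run alg R es (arrival e (does (e ∈? R)) d ∷ h)) F
    step : ∀ h → map Arrival.edge h ≡ ord → 𝔼 (run alg R (e ∷ es) h) F ≈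
      𝔼 (decide (rule ord e) R h e) (rest h)
    step h eq = ≈-trans
      (𝔼->>= (decide alg R h e) λ d → run alg R es (arrival e (does (e ∈? R)) d ∷ h))
      (≡⇒≈ (cong (λ d → 𝔼 d (rest h)) (decide-cong alg (rule ord e) R h e
        (cong (λ ord → attenuate (addable ord e)) eq))))

  𝔼-outcome : ∀ es (F : Subset #edges × Subset #edges → ℝ) → 𝔼 (outcome alg x es) F ≈
    𝔼 (randomSubset x) λ R → 𝔼 (hist (es ʳ++ []) R) λ h → F (R , selection h)
  𝔼-outcome es F =
    ≈-trans (𝔼->>= (randomSubset x) λ R → run alg R es [] >>= λ h → pure (R , selection h))
      (𝔼-cong (randomSubset x) λ R → begin-equality
        𝔼 (run alg R es [] >>= λ h → pure (R , selection h)) F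
          ≈⟨ 𝔼->>= (run alg R es []) (λ h → pure (R , selection h)) ⟩
        𝔼 (run alg R es []) (λ h → 𝔼 (pure (R , selection h)) F)
          ≈⟨ 𝔼-cong (run alg R es []) (λ h → 𝔼-pure (R , selection h) F) ⟩
        𝔼 (run alg R es []) (λ h → F (R , selection h))
          ≈⟨ 𝔼-pure [] (λ h → 𝔼 (run alg R es h) (λ h → F (R , selection h))) ⟨
        𝔼 (hist [] R) (λ h → 𝔼 (run alg R es h) (λ h → F (R , selection h)))
          ≈⟨ 𝔼-run es [] R (λ h → F (R , selection h)) ⟩
        𝔼 (hist (es ʳ++ []) R) (λ h → F (R , selection h)) ∎)

  -- Only the membership bits of arrived edges are ever consulted.
  hist-indep : ∀ {e} ord → e List.∉ ord → ∀ R b (F : History → ℝ) →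
    𝔼 (hist ord (R [ e ]≔ b)) F ≈ 𝔼 (hist ord R) F
  hist-indep          []        e∉ R b F = ≈-refl
  hist-indep {e} (f ∷ ord) e∉ R b F = begin-equality
    𝔼 (hist (f ∷ ord) (R [ e ]≔ b)) F
      ≈⟨ 𝔼-hist-∷ f ord (R [ e ]≔ b) F ⟩
    𝔼 (hist ord (R [ e ]≔ b)) (G′ (does (f ∈? R [ e ]≔ b)))
      ≈⟨ hist-indep ord (e∉ ∘ there) R b _ ⟩
    𝔼 (hist ord R) (G′ (does (f ∈? R [ e ]≔ b)))
      ≈⟨ ≡⇒≈ (cong (λ c → 𝔼 (hist ord R) (G′ c)) (∈?-[]≔ (λ f≡e → e∉ (here (sym f≡e))) R b)) ⟩
    𝔼 (hist ord R) (G′ (does (f ∈? R)))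
      ≈⟨ 𝔼-hist-∷ f ord R F ⟨
    𝔼 (hist (f ∷ ord) R) F ∎
    where
    G′ : Bool → History → ℝ
    G′ c h = 𝔼 (if c ∧ does (isMatching? (selection h ∪ ⁅ f ⁆))
                then bernoulli (factor (addable ord f)) else pure false)
               λ d → F (arrival f c d ∷ h)

  -- Selection probabilities before, at and after an arrival

  selection⊆arrived : ∀ {f} h → f ∈ selection h → f List.∈ map Arrival.edge h
  selection⊆arrived []                      f∈ = contradiction f∈ ∉⊥
  selection⊆arrived (arrival e _ false ∷ h) f∈ = there (selection⊆arrived h f∈)
  selection⊆arrived (arrival e _ true  ∷ h) f∈ with x∈p∪q⁻ (selection h) ⁅ e ⁆ f∈
  ... | inj₁ f∈I = there (selection⊆arrived h f∈I)
  ... | inj₂ f∈e = here (x∈⁅y⁆⇒x≡y e f∈e)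

  selects-other : ∀ {e f} b d h → f ≢ e →
    does (f ∈? selection (arrival e b d ∷ h)) ≡ does (f ∈? selection h)
  selects-other         b false h f≢e = refl
  selects-other {e} {f} b true  h f≢e = does-⇔ (mk⇔ from (x∈p∪q⁺ ∘ inj₁)) (f ∈? _) (f ∈? _)
    where
    from : f ∈ selection h ∪ ⁅ e ⁆ → f ∈ selection h
    from f∈ with x∈p∪q⁻ (selection h) ⁅ e ⁆ f∈
    ... | inj₁ f∈I = f∈I
    ... | inj₂ f∈e = contradiction (x∈⁅y⁆⇒x≡y e f∈e) f≢e

  selects-arriving : ∀ {e} b d h → ¬ e ∈ selection h →
    does (e ∈? selection (arrival e b d ∷ h)) ≡ d
  selects-arriving     b false h e∉I = dec-false (_ ∈? _) e∉I
  selects-arriving {e} b true  h e∉I = dec-true (_ ∈? _) (x∈p∪q⁺ {p = selection h} (inj₂ (x∈⁅x⁆ e)))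

  selected-∉ : ∀ {ord f} → f List.∉ ord → selected ord f ≈ 0ℝ
  selected-∉ {ord} {f} f∉ = ≈-trans
    (𝔼-congˢ (joint-supported ord) λ h (eq , _) →
      ≡⇒≈ (cong ⟦_⟧ (dec-false (f ∈? selection h) λ f∈ →
        f∉ (subst (f List.∈_) eq (selection⊆arrived h f∈)))))
    (𝔼-0 (joint ord))

  -- Decisions are irrevocable and concern only the arriving edge, so the coin of `e` integrates
  -- out.
  selected-other : ∀ {e f} ord → f ≢ e → selected (e ∷ ord) f ≈ selected ord f
  selected-other {e} {f} ord f≢e = begin-equality
    selected (e ∷ ord) f
      ≈⟨ 𝔼-joint (e ∷ ord) (λ h → ⟦ does (f ∈? selection h) ⟧) ⟩
    𝔼 (randomSubset x) (λ R → 𝔼 (hist (e ∷ ord) R) (λ h → ⟦ does (f ∈? selection h) ⟧))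
      ≈⟨ 𝔼-cong (randomSubset x) unchanged ⟩
    𝔼 (randomSubset x) (λ R → 𝔼 (hist ord R) (λ h → ⟦ does (f ∈? selection h) ⟧))
      ≈⟨ 𝔼-joint ord (λ h → ⟦ does (f ∈? selection h) ⟧) ⟨
    selected ord f ∎
    where
    unchanged : ∀ R → 𝔼 (hist (e ∷ ord) R) (λ h → ⟦ does (f ∈? selection h) ⟧) ≈
                      𝔼 (hist ord R) (λ h → ⟦ does (f ∈? selection h) ⟧)
    unchanged R = ≈-trans (𝔼-hist-∷ e ord R _) (𝔼-cong (hist ord R) λ h →
      ≈-trans
        (𝔼-cong (decide (rule ord e) R h e) λ d → ≡⇒≈ (cong ⟦_⟧ (selects-other _ d h f≢e)))
        (mass-decide (rule ord e) R h e ⟦ does (f ∈? selection h) ⟧))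

  -- Freshness of `e` enters twice: an unselected `e` is in the new selection exactly when its coin
  -- says so, and the earlier history ignores the bit of `e`, so activity factors out.
  selected-arriving : ∀ {e} ord → e List.∉ ord →
    selected (e ∷ ord) e ≈ x e * (factor (addable ord e) * addable ord e)
  selected-arriving {e} ord e∉ = begin-equality
    selected (e ∷ ord) e
      ≈⟨ 𝔼-joint (e ∷ ord) (λ h → ⟦ does (e ∈? selection h) ⟧) ⟩
    𝔼 (randomSubset x) (λ R → 𝔼 (hist (e ∷ ord) R) (λ h → ⟦ does (e ∈? selection h) ⟧))
      ≈⟨ 𝔼-cong (randomSubset x) now ⟩
    𝔼 (randomSubset x) (λ R → ⟦ does (e ∈? R) ⟧ * (v * 𝔼 (hist ord R) free))
      ≈⟨ randomSubset-indep x e (λ R → v * 𝔼 (hist ord R) free)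
           (λ R b → *-congˡ (hist-indep ord e∉ R b free)) ⟩
    x e * 𝔼 (randomSubset x) (λ R → v * 𝔼 (hist ord R) free)
      ≈⟨ *-congˡ (𝔼-*ˡ v (randomSubset x)) ⟩
    x e * (v * 𝔼 (randomSubset x) (λ R → 𝔼 (hist ord R) free))
      ≈⟨ *-congˡ (*-congˡ (𝔼-joint ord free)) ⟨
    x e * (v * addable ord e) ∎
    where
    v = factor (addable ord e)
    free : History → ℝ
    free h = ⟦ does (isMatching? (selection h ∪ ⁅ e ⁆)) ⟧
    now : ∀ R → 𝔼 (hist (e ∷ ord) R) (λ h → ⟦ does (e ∈? selection h) ⟧) ≈
                ⟦ does (e ∈? R) ⟧ * (v * 𝔼 (hist ord R) free)
    now R = begin-equality
      𝔼 (hist (e ∷ ord) R) (λ h → ⟦ does (e ∈? selection h) ⟧)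
        ≈⟨ 𝔼-hist-∷ e ord R (λ h → ⟦ does (e ∈? selection h) ⟧) ⟩
      𝔼 (hist ord R) (λ h → 𝔼 (decide (rule ord e) R h e) λ d →
        ⟦ does (e ∈? selection (arrival e (does (e ∈? R)) d ∷ h)) ⟧)
        ≈⟨ 𝔼-congˢ (hist-supported ord R) (λ h (eq , _) → ≈-trans
             (𝔼-cong (decide (rule ord e) R h e) λ d →
               ≡⇒≈ (cong ⟦_⟧ (selects-arriving _ d h λ e∈ →
                 e∉ (subst (e List.∈_) eq (selection⊆arrived h e∈)))))
             (𝔼-if (does (e ∈? R)) (does (isMatching? (selection h ∪ ⁅ e ⁆))) v)) ⟩
      𝔼 (hist ord R) (λ h → ⟦ does (e ∈? R) ⟧ * (v * free h))
        ≈⟨ 𝔼-*ˡ ⟦ does (e ∈? R) ⟧ (hist ord R) ⟩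
      ⟦ does (e ∈? R) ⟧ * 𝔼 (hist ord R) (λ h → v * free h)
        ≈⟨ *-congˡ (𝔼-*ˡ v (hist ord R)) ⟩
      ⟦ does (e ∈? R) ⟧ * (v * 𝔼 (hist ord R) free) ∎

  -- The union bound over the two endpoints

  -- A count instead of the indicator that v is covered: by linearity its expectation is a sum of
  -- selection probabilities, to which the vertex constraint on `x` applies.
  matched : Vertex → Subset #edges → ℝ
  matched v I = ∑ (map (λ f → ⟦ does (f ∈? I) ⟧) (incidentEdges v))

  0≼matched : ∀ v I → 0ℝ ≼ matched v I
  0≼matched v I = ∑-0≼ (λ f → 0≼⟦⟧ (does (f ∈? I))) (incidentEdges v)

  1≼matched : ∀ {v I f} → f ∈ I → Incident v f → 1ℝ ≼ matched v I
  1≼matched {v} {I} {f} f∈I inc = begin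
    1ℝ                 ≈⟨ ≡⇒≈ (cong ⟦_⟧ (dec-true (f ∈? I) f∈I)) ⟨
    ⟦ does (f ∈? I) ⟧  ∼⟨ term≼∑ (λ f → 0≼⟦⟧ (does (f ∈? I))) (∈-incidentEdges inc) ⟩
    matched v I        ∎

  matching-∪ : ∀ {I e} → IsMatching I → (∀ f → f ∈ I → ∀ v → Incident v e → ¬ Incident v f) →
    IsMatching (I ∪ ⁅ e ⁆)
  matching-∪ {I} {e} m disjoint a a∈ b b∈ v va vb
    with x∈p∪q⁻ I ⁅ e ⁆ a∈ | x∈p∪q⁻ I ⁅ e ⁆ b∈
  ... | inj₁ a∈I | inj₁ b∈I = m a a∈I b b∈I v va vb
  ... | inj₂ a∈e | inj₂ b∈e = trans (x∈⁅y⁆⇒x≡y e a∈e) (sym (x∈⁅y⁆⇒x≡y e b∈e))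
  ... | inj₁ a∈I | inj₂ b∈e =
    contradiction va (disjoint a a∈I v (subst (Incident v) (x∈⁅y⁆⇒x≡y e b∈e) vb))
  ... | inj₂ a∈e | inj₁ b∈I =
    contradiction vb (disjoint b b∈I v (subst (Incident v) (x∈⁅y⁆⇒x≡y e a∈e) va))

  -- If I meets neither endpoint of `e`, then `matching-∪` makes `e` addable; so one of the three
  -- nonnegative summands always reaches 1. Proved outcome by outcome, it leaves only linearity and
  -- monotonicity of the expectation.
  union-bound : ∀ {I} e → IsMatching I →
    1ℝ ≼ ⟦ does (isMatching? (I ∪ ⁅ e ⁆)) ⟧ + (matched (end₁ e) I + matched (end₂ e) I)
  union-bound {I} e m = cases (isMatching? (I ∪ ⁅ e ⁆)) (meets? (end₁ e)) (meets? (end₂ e))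
    where
    Meets : Vertex → Set
    Meets v = ∃ λ f → f ∈ I × Incident v f
    meets? : ∀ v → Dec (Meets v)
    meets? v = Fin.any? λ f → (f ∈? I) ×-dec incident? v f
    cases : (free? : Dec (IsMatching (I ∪ ⁅ e ⁆))) → Dec (Meets (end₁ e)) → Dec (Meets (end₂ e)) →
      1ℝ ≼ ⟦ does free? ⟧ + (matched (end₁ e) I + matched (end₂ e) I)
    cases free? (yes (f , f∈I , inc)) _ =
      ≼-trans (1≼matched f∈I inc)
        (≼-trans (x≼x+y (0≼matched (end₂ e) I)) (y≼x+y (0≼⟦⟧ (does free?))))
    cases free? (no _) (yes (f , f∈I , inc)) =
      ≼-trans (1≼matched f∈I inc)
        (≼-trans (y≼x+y (0≼matched (end₁ e) I)) (y≼x+y (0≼⟦⟧ (does free?))))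
    cases (yes _) (no _) (no _) = x≼x+y (0≼x+y (0≼matched (end₁ e) I) (0≼matched (end₂ e) I))
    cases (no ¬free) (no ¬u) (no ¬v) = contradiction (matching-∪ m disjoint) ¬free
      where
      disjoint : ∀ f → f ∈ I → ∀ v → Incident v e → ¬ Incident v f
      disjoint f f∈I v (inj₁ refl) vf = ¬u (f , f∈I , vf)
      disjoint f f∈I v (inj₂ refl) vf = ¬v (f , f∈I , vf)

  -- `matched` ranges over all edges at a vertex, arrived or not, so the upper bound is asked of
  -- every edge f.
  ⅓≼addable : ∀ ord e → (∀ f → selected ord f ≼ ⅓ * x f) → ⅓ ≼ addable ord e
  ⅓≼addable ord e bound = begin
    ⅓                                          ≈⟨ termwise (λ _ → refl) ⟩
    1ℝ - (⅓ + ⅓)                               ∼⟨ +-mono-≼ 1≼ ≼-refl ⟩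
    (addable ord e + (⅓ + ⅓)) - (⅓ + ⅓)        ≈⟨ cancel (addable ord e) (⅓ + ⅓) ⟩
    addable ord e                              ∎
    where
    cancel : ∀ p q → (p + q) - q ≈ p
    cancel p q = termwise λ n → solve 2 (λ p q → (p :+ q) :- q := p) refl (seq p n) (seq q n)

    𝔼-matched : ∀ v → 𝔼 (joint ord) (λ h → matched v (selection h)) ≼ ⅓
    𝔼-matched v = begin
      𝔼 (joint ord) (λ h → matched v (selection h))     ≈⟨ 𝔼-∑ (joint ord) (incidentEdges v) ⟩
      ∑ (map (selected ord) (incidentEdges v))          ∼⟨ ∑-mono bound (incidentEdges v) ⟩
      ∑ (map (λ f → ⅓ * x f) (incidentEdges v))         ≈⟨ ∑-*ˡ ⅓ (incidentEdges v) ⟩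
      ⅓ * ∑ (map x (incidentEdges v))                   ∼⟨ *-monoˡ-≼ 0≼⅓ (wrap (proj₂ x∈𝓕 v)) ⟩
      ⅓ * 1ℝ                                            ≈⟨ *-identityʳ ⅓ ⟩
      ⅓                                                 ∎

    free matched₁ matched₂ : History → ℝ
    free h     = ⟦ does (isMatching? (selection h ∪ ⁅ e ⁆)) ⟧
    matched₁ h = matched (end₁ e) (selection h)
    matched₂ h = matched (end₂ e) (selection h)

    1≼ : 1ℝ ≼ addable ord e + (⅓ + ⅓)
    1≼ = begin
      1ℝ
        ≈⟨ mass-joint ord 1ℝ ⟨
      𝔼 (joint ord) (λ _ → 1ℝ)
        ∼⟨ 𝔼-monoˢ (joint-supported ord) (λ h (_ , m) → union-bound e m) ⟩
      𝔼 (joint ord) (λ h → free h + (matched₁ h + matched₂ h))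
        ≈⟨ ≈-trans (𝔼-+ (joint ord)) (+-cong ≈-refl (𝔼-+ (joint ord))) ⟩
      addable ord e + (𝔼 (joint ord) matched₁ + 𝔼 (joint ord) matched₂)
        ∼⟨ +-mono-≼ ≼-refl (+-mono-≼ (𝔼-matched (end₁ e)) (𝔼-matched (end₂ e))) ⟩
      addable ord e + (⅓ + ⅓) ∎

  -- Matching upper and lower bounds on selection

  -- The probability of f starts at zero and changes only when f arrives, where `factor*x≼⅓`
  -- applies. This induction stands alone, so the lower bound can use its result for the past of
  -- each edge.
  selected-≼ : ∀ {ord} → Unique ord → ∀ f → selected ord f ≼ ⅓ * x f
  selected-≼ {[]} _ f = ≼-trans (≼-reflexive (selected-∉ {[]} {f} λ ())) (0≼x*y 0≼⅓ (0≼x f))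
  selected-≼ {e ∷ ord} (e∉ ∷ u) f with f Fin.≟ e
  ... | no f≢e   = ≼-trans (≼-reflexive (selected-other ord f≢e)) (selected-≼ u f)
  ... | yes refl = begin
    selected (e ∷ ord) e                                ≈⟨ selected-arriving ord (All.All¬⇒¬Any e∉) ⟩
    x e * (factor (addable ord e) * addable ord e)      ∼⟨ *-monoˡ-≼ (0≼x e) (factor*x≼⅓ (addable ord e)) ⟩
    x e * ⅓                                             ≈⟨ *-comm (x e) ⅓ ⟩
    ⅓ * x e                                             ∎

  -- When f arrives, the upper bound on the earlier order yields `⅓≼addable`, which makes the cap
  -- inactive; later arrivals leave the probability unchanged.
  ≼-selected : ∀ {ord} → Unique ord → ∀ {f} → f List.∈ ord → ⅓ * x f ≼ selected ord f
  ≼-selected {e ∷ ord} (e∉ ∷ u) {f} f∈ with f Fin.≟ e | f∈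
  ... | no f≢e   | here f≡e = contradiction f≡e f≢e
  ... | no f≢e   | there f∈ord =
    ≼-trans (≼-selected u f∈ord) (≼-reflexive (≈-sym (selected-other ord f≢e)))
  ... | yes refl | _ = begin
    ⅓ * x e                                             ≈⟨ *-comm ⅓ (x e) ⟩
    x e * ⅓                                             ∼⟨ *-monoˡ-≼ (0≼x e) (⅓≼factor*x (⅓≼addable ord e (selected-≼ u))) ⟩
    x e * (factor (addable ord e) * addable ord e)      ≈⟨ selected-arriving ord (All.All¬⇒¬Any e∉) ⟨
    selected (e ∷ ord) e                                ∎

  -- Conditioning on activity

  ℙ-active : ∀ es e → ℙ (outcome alg x es) (e∈R? e) ≈ x e
  ℙ-active es e = begin-equality
    ℙ (outcome alg x es) (e∈R? e)
      ≈⟨ ℙ≈𝔼 (outcome alg x es) (e∈R? e) ⟩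
    𝔼 (outcome alg x es) (λ (R , I) → ⟦ does (e ∈? R) ⟧)
      ≈⟨ 𝔼-outcome es (λ (R , I) → ⟦ does (e ∈? R) ⟧) ⟩
    𝔼 (randomSubset x) (λ R → 𝔼 (hist (es ʳ++ []) R) (λ _ → ⟦ does (e ∈? R) ⟧))
      ≈⟨ 𝔼-cong (randomSubset x) (λ R → ≈-trans
           (mass-hist (es ʳ++ []) R ⟦ does (e ∈? R) ⟧) (≈-sym (*-identityʳ _))) ⟩
    𝔼 (randomSubset x) (λ R → ⟦ does (e ∈? R) ⟧ * 1ℝ)
      ≈⟨ randomSubset-indep x e (λ _ → 1ℝ) (λ _ _ → ≈-refl) ⟩
    x e * 𝔼 (randomSubset x) (λ _ → 1ℝ)
      ≈⟨ ≈-trans (*-congˡ (mass-randomSubset x 1ℝ)) (*-identityʳ (x e)) ⟩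
    x e ∎

  ℙ-selected : ∀ es e →
    ℙ (outcome alg x es) (e∈I? e ∩? e∈R? e) ≈ selected (es ʳ++ []) e
  ℙ-selected es e = begin-equality
    ℙ (outcome alg x es) (e∈I? e ∩? e∈R? e)
      ≈⟨ ℙ≈𝔼 (outcome alg x es) (e∈I? e ∩? e∈R? e) ⟩
    𝔼 (outcome alg x es) (λ (R , I) → ⟦ does (e ∈? I) ∧ does (e ∈? R) ⟧)
      -- Selected edges are active in every listed outcome, so intersecting with activity changes
      -- nothing.
      ≈⟨ 𝔼-congˢ (outcome-supported alg es) (λ (R , I) (I⊆R , _) → ≡⇒≈ (cong ⟦_⟧
           (does-⇔ (mk⇔ proj₁ (λ e∈I → e∈I , I⊆R e∈I)) ((e ∈? I) ×-dec (e ∈? R)) (e ∈? I)))) ⟩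
    𝔼 (outcome alg x es) (λ (R , I) → ⟦ does (e ∈? I) ⟧)
      ≈⟨ 𝔼-outcome es (λ (R , I) → ⟦ does (e ∈? I) ⟧) ⟩
    𝔼 (randomSubset x) (λ R → 𝔼 (hist (es ʳ++ []) R) (λ h → ⟦ does (e ∈? selection h) ⟧))
      ≈⟨ 𝔼-joint (es ʳ++ []) (λ h → ⟦ does (e ∈? selection h) ⟧) ⟨
    selected (es ʳ++ []) e ∎

  isSelectable : IsSelectableOCRS ⅓ x alg
  isSelectable = record
    { selectsMatching = λ es _ → All.map proj₂ (outcome-supported alg es)
    ; selectable = λ es es↭ e 0<x →
        let pos    = <-≼-trans {0ℝ} {x e} 0<x (≼-reflexive (≈-sym (ℙ-active es e)))
            -- `hist` keeps the latest arrival first, so the relevant order is `es` reversed, which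
            -- is still a permutation of the edges and therefore free of repetitions.
            ord↭   = ↭-trans (↭-sym (++↭ʳ++ es [])) (↭-trans (++-identityʳ es) es↭)
            unique = Unique-resp-↭ (setoid Edge) (↭⇒↭ₛ (↭-sym ord↭)) (allFin⁺ #edges)
            e∈ord  = ∈-resp-↭ (↭-sym ord↭) (∈-allFin e)
        in pos , unwrap (c≼x*recip pos 0≼⅓ (begin
          ⅓ * ℙ (outcome alg x es) (e∈R? e)          ≈⟨ *-congˡ {⅓} (ℙ-active es e) ⟩
          ⅓ * x e                                    ∼⟨ ≼-selected unique e∈ord ⟩
          selected (es ʳ++ []) e                     ≈⟨ ℙ-selected es e ⟨
          ℙ (outcome alg x es) (e∈I? e ∩? e∈R? e)    ∎)) }

theorem5p1 : (G : Graph) (x : Graph.Edge G → ℝ) → Graph.𝓕 G x →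
    ∃ λ (alg : Online.Algorithm G) → Online.IsSelectableOCRS G ⅓ x alg
theorem5p1 G x x∈𝓕 = OCRS.alg G x x∈𝓕 , OCRS.isSelectable G x x∈𝓕
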